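{- Let $(R,+,\cdot,0,1,<)$ be a non-Archimedean real closed field. Assume that $R$ admits an integer part whose non-negative cone is a model of $I\Delta_0+EXP$. Then $R$ admits a left exponential function, i.e. $R$ admits left exponentiation.
   Context: Integer part: an integer part of an ordered field $R$ is a discretely ordered subring $Z\subseteq R$ such that for every $r\in R$ there is $z\in Z$ with $z\le r<z+1$. Its non-negative cone is $Z^{\ge0}$, regarded as a structure in the language $\{+,\cdot,0,1,<\}$. $I\Delta_0$ is the theory of non-negative cones of discretely ordered commutative rings with $1$ together with the induction axiom for every bounded ($\Delta_0$) formula of $\{+,\cdot,0,1,<\}$, i.e. every formula in which all quantifiers are bounded by terms of the language. There is a $\Delta_0$-formula $E(x,y)$ defining the graph of $y=2^x$ in $\mathbb{N}$ for which $I\Delta_0$ proves the usual properties of exponentiation other than totality: $E(0,1)$ and $E(1,2)$; for each $x$ there is at most one $y$ with $E(x,y)$; $x\ge1\wedge E(x,y)\to y\ge x+1$; $E(a,c)\wedge E(b,d)\to E(a+b,cd)$; $E(a,c)\wedge E(b,d)\wedge a<b\to c<d$; and for every $x\ge1$ there is a unique $y$ such that for some $z$, $E(y,z)$ and $z\le x<2z$. Fix such a formula. $EXP$ is the axiom $\forall x\,\exists! y\,E(x,y)$, and $I\Delta_0+EXP$ is $I\Delta_0$ together with $EXP$. Natural valuation: for non-zero $x,y\in R$ put $x\sim y$ if there is $n\in\mathbb{N}$ with $n|x|\ge|y|$ and $n|y|\ge|x|$; let $v(x)$ be the $\sim$-class of $x$, with the classes ordered by $v(y)<v(x)$ iff $n|x|<|y|$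 for all $n\in\mathbb{N}$, with addition $v(x)+v(y)=v(xy)$, and $v(0)=\infty$. Put $R_v=\{a\in R:v(a)\ge0\}$ (the convex hull of $\mathbb{Z}$ in $R$) and $\mathcal{U}_v^{>0}=\{a\in R:a>0,\ v(a)=0\}$. Left exponentiation: the ordered groups $(R,+,0,<)$ and $(R^{>0},\cdot,1,<)$ are divisible, i.e. ordered $\mathbb{Q}$-vector spaces. $R$ admits left exponentiation if there is an order preserving group isomorphism (a left exponential function) from some ($\mathbb{Q}$-vector space) complement $A$ of $R_v$ in $(R,+,0,<)$ onto some ($\mathbb{Q}$-vector space) complement $B$ of $\mathcal{U}_v^{>0}$ in $(R^{>0},\cdot,1,<)$. -}

module Defs where

open import Algebra.Bundles using (AbelianGroup; CommutativeRing; RawGroup; RawSemiring)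
open import Algebra.Morphism.Structures using (module GroupMorphisms)
import Algebra.Definitions.RawMonoid as RawMonoidDefinitions
import Algebra.Morphism.RingMonomorphism as RingMonomorphism
import Algebra.Properties.Ring as RingProperties
open import Data.Fin.Base using (Fin)
open import Data.Integer.Base as ℤ using (ℤ; -[1+_])
open import Data.Nat.Base as ℕ using (ℕ)
open import Data.Product.Base using (Σ; ∃; ∃-syntax; _×_; _,_; proj₁; proj₂)
open import Data.Product using (∃!)
open import Data.Rational.Base as ℚ using (ℚ)
open import Data.Sum.Base using (_⊎_; inj₁; inj₂)
open import Data.Vec.Base using (Vec; []; _∷_; _∷ʳ_; lookup)
open import Function.Base using (_on_; id)
open import Function.Bundles using (_⇔_)
open import Level using (0ℓ; _⊔_; suc)
open import Relation.Binary.Bundles using (Poset)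
open import Relation.Binary.Core using (Rel)
open import Relation.Binary.Definitions using (tri<; tri≈; tri>; _Respects_)
import Relation.Binary.Construct.On as On
open import Relation.Binary.PropositionalEquality.Core using (_≡_)
open import Relation.Binary.Structures using (IsStrictTotalOrder)
open import Relation.Nullary.Negation.Core using (¬_; contradiction)
open import Relation.Unary using (Pred; _∈_)

------------------------------------------------------------------------
-- Choice

-- The chain condition includes the empty chain, so P is inhabited.
ZornsLemma : ∀ c ℓ₁ ℓ₂ p → Set (suc (c ⊔ ℓ₁ ⊔ ℓ₂ ⊔ p))
ZornsLemma c ℓ₁ ℓ₂ p =
  (P : Poset c ℓ₁ ℓ₂) → let open Poset P in
  ((C : Pred Carrier p) →
     (∀ {x y} → x ∈ C → y ∈ C → x ≤ y ⊎ y ≤ x) →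
     ∃[ u ] (∀ {x} → x ∈ C → x ≤ u)) →
  ∃[ m ] (∀ {x} → m ≤ x → x ≈ m)

------------------------------------------------------------------------
-- Structures and Δ₀-formulas in the language {+, ·, 0, 1, <}

record Structure ℓ : Set (suc ℓ) where
  infix 4 _<_ _≤_
  field
    rawSemiring : RawSemiring ℓ ℓ
  open RawSemiring rawSemiring public using (Carrier; _≈_; _+_; _*_; 0#; 1#)
  field
    _<_ : Rel Carrier ℓ

  _≤_ : Rel Carrier ℓ
  x ≤ y = x < y ⊎ x ≈ y

ℕ-structure : Structure 0ℓ
ℕ-structure = record { rawSemiring = ℕ.+-*-rawSemiring ; _<_ = ℕ._<_ }

infixl 6 _⊕_
infixl 7 _⊛_
infix  4 _≐_ _≺_
infixr 3 _∧ᶠ_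
infixr 2 _∨ᶠ_
infixr 1 _⇒ᶠ_

data Term (n : ℕ) : Set where
  var     : Fin n → Term n
  zeroᵗ   : Term n
  oneᵗ    : Term n
  _⊕_ _⊛_ : Term n → Term n → Term n

-- De Bruijn indices: a quantifier binds variable zero of its body, and the
-- bounding term, living in the outer scope, cannot mention that variable.
data Δ₀ (n : ℕ) : Set where
  _≐_ _≺_          : Term n → Term n → Δ₀ n
  ¬ᶠ_              : Δ₀ n → Δ₀ n
  _∧ᶠ_ _∨ᶠ_ _⇒ᶠ_   : Δ₀ n → Δ₀ n → Δ₀ n
  ∀<_,_ ∃<_,_      : Term n → Δ₀ (ℕ.suc n) → Δ₀ n

module _ {ℓ} (M : Structure ℓ) where
  open Structure M

  ⟦_⟧ : ∀ {n} → Term n → Vec Carrier n → Carrier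
  ⟦ var i ⟧ ρ = lookup ρ i
  ⟦ zeroᵗ ⟧ ρ = 0#
  ⟦ oneᵗ ⟧  ρ = 1#
  ⟦ s ⊕ t ⟧ ρ = ⟦ s ⟧ ρ + ⟦ t ⟧ ρ
  ⟦ s ⊛ t ⟧ ρ = ⟦ s ⟧ ρ * ⟦ t ⟧ ρ

  infix 4 _⊨_[_]
  _⊨_[_] : ∀ {n} → Δ₀ n → Vec Carrier n → Set ℓ
  _⊨_[_] (s ≐ t)    ρ = ⟦ s ⟧ ρ ≈ ⟦ t ⟧ ρ
  _⊨_[_] (s ≺ t)    ρ = ⟦ s ⟧ ρ < ⟦ t ⟧ ρ
  _⊨_[_] (¬ᶠ φ)     ρ = ¬ (_⊨_[_] φ ρ)
  _⊨_[_] (φ ∧ᶠ ψ)   ρ = _⊨_[_] φ ρ × _⊨_[_] ψ ρ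
  _⊨_[_] (φ ∨ᶠ ψ)   ρ = _⊨_[_] φ ρ ⊎ _⊨_[_] ψ ρ
  _⊨_[_] (φ ⇒ᶠ ψ)   ρ = _⊨_[_] φ ρ → _⊨_[_] ψ ρ
  _⊨_[_] (∀< t , φ) ρ = ∀ x → x < ⟦ t ⟧ ρ → _⊨_[_] φ (x ∷ ρ)
  _⊨_[_] (∃< t , φ) ρ = ∃[ x ] (x < ⟦ t ⟧ ρ × _⊨_[_] φ (x ∷ ρ))

  Δ₀-Induction : Set ℓ
  Δ₀-Induction =
    ∀ {n} (φ : Δ₀ (ℕ.suc n)) (ρ : Vec Carrier n) →
    _⊨_[_] φ (0# ∷ ρ) →
    (∀ x → _⊨_[_] φ (x ∷ ρ) → _⊨_[_] φ (x + 1# ∷ ρ)) →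
    ∀ x → _⊨_[_] φ (x ∷ ρ)

------------------------------------------------------------------------
-- Ordered rings and their non-negative cones

record OrderedRing ℓ : Set (suc ℓ) where
  infix 4 _<_ _≤_
  field
    commutativeRing : CommutativeRing ℓ ℓ
  open CommutativeRing commutativeRing public
  field
    _<_                : Rel Carrier ℓ
    isStrictTotalOrder : IsStrictTotalOrder _≈_ _<_
    +-monoˡ-<          : ∀ z {x y} → x < y → x + z < y + z
    *-pos              : ∀ {x y} → 0# < x → 0# < y → 0# < x * y
    0<1                : 0# < 1#

  open IsStrictTotalOrder isStrictTotalOrder public
    using (compare; irrefl; <-resp-≈; <-respˡ-≈; <-respʳ-≈)
    renaming (trans to <-trans)

  _≤_ : Rel Carrier ℓ
  x ≤ y = x < y ⊎ x ≈ y

  ∣_∣ : Carrier → Carrier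
  ∣ x ∣ with compare x 0#
  ... | tri< _ _ _ = - x
  ... | tri≈ _ _ _ = x
  ... | tri> _ _ _ = x

  open RawMonoidDefinitions +-rawMonoid public using ()
    renaming (_×_ to _·_)

  -- Coefficients are listed from the constant term upwards.
  eval : ∀ {n} → Vec Carrier n → Carrier → Carrier
  eval []      x = 0#
  eval (a ∷ p) x = a + x * eval p x

  IsDiscrete : Set ℓ
  IsDiscrete = ∀ x → ¬ (0# < x × x < 1#)

  IsArchimedean : Set ℓ
  IsArchimedean = ∀ x → ∃[ n ] x < n · 1#

  private
    module RP = RingProperties ring

  +-nonneg : ∀ {x y} → 0# ≤ x → 0# ≤ y → 0# ≤ x + y
  +-nonneg {x} {y} (inj₁ 0<x) (inj₁ 0<y) =
    inj₁ (<-trans 0<y (<-respˡ-≈ (+-identityˡ y) (+-monoˡ-< y 0<x)))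
  +-nonneg {x} {y} (inj₁ 0<x) (inj₂ 0≈y) =
    inj₁ (<-respʳ-≈ (trans (sym (+-identityʳ x)) (+-congˡ 0≈y)) 0<x)
  +-nonneg {x} {y} (inj₂ 0≈x) (inj₁ 0<y) =
    inj₁ (<-respʳ-≈ (trans (sym (+-identityˡ y)) (+-congʳ 0≈x)) 0<y)
  +-nonneg {x} {y} (inj₂ 0≈x) (inj₂ 0≈y) =
    inj₂ (trans (sym (+-identityˡ 0#)) (+-cong 0≈x 0≈y))

  *-nonneg : ∀ {x y} → 0# ≤ x → 0# ≤ y → 0# ≤ x * y
  *-nonneg         (inj₁ 0<x) (inj₁ 0<y) = inj₁ (*-pos 0<x 0<y)
  *-nonneg {x} {y} (inj₁ 0<x) (inj₂ 0≈y) = inj₂ (trans (sym (zeroʳ x)) (*-congˡ 0≈y))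
  *-nonneg {x} {y} (inj₂ 0≈x) _          = inj₂ (trans (sym (zeroˡ y)) (*-congʳ 0≈x))

  cone : Structure ℓ
  cone = record
    { rawSemiring = record
      { Carrier = Σ Carrier (0# ≤_)
      ; _≈_     = λ x y → proj₁ x ≈ proj₁ y
      ; _+_     = λ (x , 0≤x) (y , 0≤y) → x + y , +-nonneg 0≤x 0≤y
      ; _*_     = λ (x , 0≤x) (y , 0≤y) → x * y , *-nonneg 0≤x 0≤y
      ; 0#      = 0# , inj₂ refl
      ; 1#      = 1# , inj₁ 0<1
      }
    ; _<_ = λ x y → proj₁ x < proj₁ y
    }

  neg⇒pos : ∀ {x} → x < 0# → 0# < - x
  neg⇒pos {x} x<0 =
    <-respˡ-≈ (-‿inverseʳ x) (<-respʳ-≈ (+-identityˡ (- x)) (+-monoˡ-< (- x) x<0))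

  0≮-1 : ¬ (0# < - 1#)
  0≮-1 0<-1 = irrefl refl
    (<-trans 0<1 (<-respʳ-≈ (-‿inverseˡ 1#) (<-respˡ-≈ (+-identityˡ 1#) (+-monoˡ-< 1# 0<-1))))

  factor-pos : ∀ {x y} → 0# < x → x * y ≈ 1# → 0# < y
  factor-pos {x} {y} 0<x xy≈1 with compare 0# y
  ... | tri< 0<y _ _ = 0<y
  ... | tri≈ _ 0≈y _ = contradiction 0<1
    (irrefl (trans (sym (zeroʳ x)) (trans (*-congˡ 0≈y) xy≈1)))
  ... | tri> _ _ y<0 = contradiction
    (<-respʳ-≈ (trans (sym (RP.-‿distribʳ-* x y)) (-‿cong xy≈1)) (*-pos 0<x (neg⇒pos y<0)))
    0≮-1

------------------------------------------------------------------------
-- IΔ₀, exponentiation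

-- The non-negative cone of D is a model of IΔ₀.
record ConeModelsIΔ₀ {ℓ} (D : OrderedRing ℓ) : Set ℓ where
  open OrderedRing D
  field
    isDiscrete   : IsDiscrete
    Δ₀-induction : Δ₀-Induction cone

module _ {ℓ} (M : Structure ℓ) (E : Δ₀ 2) where
  open Structure M

  private
    2# : Carrier
    2# = 1# + 1#

    Exp : Carrier → Carrier → Set ℓ
    Exp x y = M ⊨ E [ x ∷ y ∷ [] ]

  record ExponentialLaws : Set ℓ where
    field
      exp-0      : Exp 0# 1#
      exp-1      : Exp 1# 2#
      functional : ∀ x y y′ → Exp x y → Exp x y′ → y ≈ y′
      growth     : ∀ x y → 1# ≤ x → Exp x y → x + 1# ≤ y
      sum        : ∀ a b c d → Exp a c → Exp b d → Exp (a + b) (c * d)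
      monotone   : ∀ a b c d → Exp a c → Exp b d → a < b → c < d
      logarithm  : ∀ x → 1# ≤ x →
                   ∃! _≈_ λ y → ∃[ z ] (Exp y z × z ≤ x × x < 2# * z)

  EXP : Set ℓ
  EXP = ∀ x → ∃! _≈_ λ y → Exp x y

-- E defines the graph of y = 2ˣ in ℕ, and IΔ₀ proves the laws for E.
-- "IΔ₀ proves" is read as truth in every model of IΔ₀.
record IsExponentialFormula ℓ (E : Δ₀ 2) : Set (suc ℓ) where
  field
    standard : ∀ m n → (ℕ-structure ⊨ E [ m ∷ n ∷ [] ]) ⇔ (n ≡ 2 ℕ.^ m)
    provable : (D : OrderedRing ℓ) → ConeModelsIΔ₀ D →
               ExponentialLaws (OrderedRing.cone D) E

------------------------------------------------------------------------
-- Real closed fields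

record RealClosedField ℓ : Set (suc ℓ) where
  field
    orderedRing : OrderedRing ℓ
  open OrderedRing orderedRing public
  field
    inverse  : ∀ x → ¬ x ≈ 0# → ∃[ y ] x * y ≈ 1#
    sqrt     : ∀ x → 0# < x → ∃[ y ] y * y ≈ x
    odd-root : ∀ k (p : Vec Carrier (ℕ.suc (2 ℕ.* k))) (a : Carrier) → ¬ a ≈ 0# →
               ∃[ x ] eval (p ∷ʳ a) x ≈ 0#

------------------------------------------------------------------------
-- Integer parts

record IsSubring {ℓ} (R : OrderedRing ℓ) (Z : Pred (OrderedRing.Carrier R) ℓ) : Set ℓ where
  open OrderedRing R
  field
    resp : Z Respects _≈_
    +-∈  : ∀ {x y} → x ∈ Z → y ∈ Z → x + y ∈ Z
    *-∈  : ∀ {x y} → x ∈ Z → y ∈ Z → x * y ∈ Z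
    -‿∈  : ∀ {x} → x ∈ Z → - x ∈ Z
    0∈   : 0# ∈ Z
    1∈   : 1# ∈ Z

  subring : OrderedRing ℓ
  subring = record
    { commutativeRing = record
      { Carrier = Σ Carrier Z
      ; _≈_     = _≈_ on proj₁
      ; _+_     = λ (x , x∈) (y , y∈) → x + y , +-∈ x∈ y∈
      ; _*_     = λ (x , x∈) (y , y∈) → x * y , *-∈ x∈ y∈
      ; -_      = λ (x , x∈) → - x , -‿∈ x∈
      ; 0#      = 0# , 0∈
      ; 1#      = 1# , 1∈
      ; isCommutativeRing = RingMonomorphism.isCommutativeRing
          (record
            { isRingHomomorphism = record
              { isSemiringHomomorphism = record
                { isNearSemiringHomomorphism = record
                  { +-isMonoidHomomorphism = record
                    { isMagmaHomomorphism = record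
                      { isRelHomomorphism = record { cong = id }
                      ; homo = λ _ _ → refl
                      }
                    ; ε-homo = refl
                    }
                  ; *-homo = λ _ _ → refl
                  }
                ; 1#-homo = refl
                }
              ; -‿homo = λ _ → refl
              }
            ; injective = id
            })
          isCommutativeRing
      }
    ; _<_                = _<_ on proj₁
    ; isStrictTotalOrder = On.isStrictTotalOrder proj₁ isStrictTotalOrder
    ; +-monoˡ-<          = λ z → +-monoˡ-< (proj₁ z)
    ; *-pos              = *-pos
    ; 0<1                = 0<1
    }

record IntegerPart {ℓ} (R : OrderedRing ℓ) : Set (suc ℓ) where
  open OrderedRing R
  field
    Z         : Pred Carrier ℓ
    isSubring : IsSubring R Z
  open IsSubring isSubring public
  field
    isDiscrete : OrderedRing.IsDiscrete subring
    floor      : ∀ r → ∃[ z ] (z ∈ Z × z ≤ r × r < z + 1#)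

------------------------------------------------------------------------
-- ℚ-subspaces and complements in divisible torsion-free abelian groups

module _ {ℓ} (G : AbelianGroup ℓ ℓ) where
  open AbelianGroup G
  open RawMonoidDefinitions rawMonoid using () renaming (_×_ to _ⁿ·_)

  _ᶻ·_ : ℤ → Carrier → Carrier
  (ℤ.+ n)  ᶻ· x = n ⁿ· x
  -[1+ n ] ᶻ· x = (ℕ.suc n ⁿ· x) ⁻¹

  -- Graph of scalar multiplication: y is q times x.  In a divisible
  -- torsion-free group there is exactly one such y.
  IsMultiple : ℚ → Carrier → Carrier → Set ℓ
  IsMultiple q x y = (ℚ.↧ q) ᶻ· y ≈ (ℚ.↥ q) ᶻ· x

  record IsℚSubspace (A : Pred Carrier ℓ) : Set ℓ where
    field
      resp : A Respects _≈_
      ε∈   : ε ∈ A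
      ∙-∈  : ∀ {x y} → x ∈ A → y ∈ A → x ∙ y ∈ A
      ⁻¹-∈ : ∀ {x} → x ∈ A → x ⁻¹ ∈ A
      ℚ-∈  : ∀ q {x y} → x ∈ A → IsMultiple q x y → y ∈ A

    subgroup : RawGroup ℓ ℓ
    subgroup = record
      { Carrier = Σ Carrier A
      ; _≈_     = _≈_ on proj₁
      ; _∙_     = λ (x , x∈) (y , y∈) → x ∙ y , ∙-∈ x∈ y∈
      ; ε       = ε , ε∈
      ; _⁻¹     = λ (x , x∈) → x ⁻¹ , ⁻¹-∈ x∈
      }

  record Complement (W : Pred Carrier ℓ) : Set (suc ℓ) where
    field
      A           : Pred Carrier ℓ
      isℚSubspace : IsℚSubspace A
      disjoint    : ∀ {x} → x ∈ A → x ∈ W → x ≈ ε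
      spanning    : ∀ x → ∃[ a ] ∃[ w ] (a ∈ A × w ∈ W × x ≈ a ∙ w)
    open IsℚSubspace isℚSubspace public

------------------------------------------------------------------------
-- Natural valuation and left exponentiation

module _ {ℓ} (R : RealClosedField ℓ) where
  open RealClosedField R

  -- x ≈ᵥ y, x <ᵥ y, x ≤ᵥ y stand for v(x) = v(y), v(x) < v(y), v(x) ≤ v(y).
  -- The clauses also give v(0) = ∞: x ≈ᵥ 0# only for x ≈ 0#, and
  -- x <ᵥ 0# exactly for x ≉ 0#.
  _≈ᵥ_ _<ᵥ_ _≤ᵥ_ : Rel Carrier ℓ
  x ≈ᵥ y = ∃[ n ] (∣ y ∣ ≤ n · ∣ x ∣ × ∣ x ∣ ≤ n · ∣ y ∣)
  x <ᵥ y = ∀ n → n · ∣ y ∣ < ∣ x ∣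
  x ≤ᵥ y = x <ᵥ y ⊎ x ≈ᵥ y

  -- The neutral element of the value group is v 1.
  Finite : Pred Carrier ℓ
  Finite a = 1# ≤ᵥ a

  Positive : Set ℓ
  Positive = Σ Carrier (0# <_)

  PositiveUnit : Pred Positive ℓ
  PositiveUnit (a , _) = a ≈ᵥ 1#

  private
    reciprocal : ((x , _) : Positive) → ∃[ y ] x * y ≈ 1#
    reciprocal (x , 0<x) = inverse x λ x≈0 → irrefl (sym x≈0) 0<x

    reciprocal-unique : ∀ {x x′ y y′} → x ≈ x′ → x * y ≈ 1# → x′ * y′ ≈ 1# → y ≈ y′
    reciprocal-unique {x} {x′} {y} {y′} x≈x′ xy≈1 x′y′≈1 =
      trans (sym (*-identityʳ y))
      (trans (*-congˡ (sym x′y′≈1))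
      (trans (sym (*-assoc y x′ y′))
      (trans (*-congʳ (trans (*-comm y x′) (trans (*-congʳ (sym x≈x′)) xy≈1)))
      (*-identityˡ y′))))

  positiveGroup : AbelianGroup ℓ ℓ
  positiveGroup = record
    { Carrier = Positive
    ; _≈_     = _≈_ on proj₁
    ; _∙_     = λ (x , 0<x) (y , 0<y) → x * y , *-pos 0<x 0<y
    ; ε       = 1# , 0<1
    ; _⁻¹     = λ p → proj₁ (reciprocal p) , factor-pos (proj₂ p) (proj₂ (reciprocal p))
    ; isAbelianGroup = record
      { isGroup = record
        { isMonoid = record
          { isSemigroup = record
            { isMagma = record
              { isEquivalence = On.isEquivalence proj₁ isEquivalence
              ; ∙-cong        = *-cong
              }
            ; assoc = λ (x , _) (y , _) (z , _) → *-assoc x y z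
            }
          ; identity = (λ (x , _) → *-identityˡ x) , (λ (x , _) → *-identityʳ x)
          }
        ; inverse = (λ p → trans (*-comm _ _) (proj₂ (reciprocal p)))
                  , (λ p → proj₂ (reciprocal p))
        ; ⁻¹-cong = λ {p} {q} p≈q →
            reciprocal-unique p≈q (proj₂ (reciprocal p)) (proj₂ (reciprocal q))
        }
      ; comm = λ (x , _) (y , _) → *-comm x y
      }
    }

  record LeftExponential : Set (suc ℓ) where
    field
      source : Complement +-abelianGroup Finite
      target : Complement positiveGroup PositiveUnit

    private
      module A = Complement source
      module B = Complement target
    open GroupMorphisms A.subgroup B.subgroup using (IsGroupIsomorphism)

    field
      exp           : Σ Carrier A.A → Σ Positive B.A
      isIsomorphism : IsGroupIsomorphism exp
      exp-mono-<    : ∀ x y → proj₁ x < proj₁ y →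
                      proj₁ (proj₁ (exp x)) < proj₁ (proj₁ (exp y))

{-# OPTIONS --safe #-}
-- Let Z be the integer part and v the natural valuation. The map r ↦ 2^⌊r⌋ turns
-- sums into products up to a factor 1 or 2. Since 2ⁿ is finite for finite n and
-- 2ᶻ ≥ z + 1 for z ≥ 1, a difference x - y in Z is bounded above by a standard natural
-- number iff the quotient 2ˣ/2ʸ is. So r ↦ 2^⌊r⌋ induces an order-preserving
-- isomorphism R/R_v → R^{>0}/U_v^{>0}, onto because every integer m ≥ 1 lies
-- between some 2ʸ and 2ʸ⁺¹. Zorn's lemma gives complements of R_v and of
-- U_v^{>0}; they are transversals of the two quotients, and the isomorphism
-- lifts to them.

module Submission where

open import Defs
open import Algebra.Bundles using (AbelianGroup)
import Algebra.Definitions.RawMonoid as RawMonoidDefinitions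
open import Algebra.Morphism.Structures using (module GroupMorphisms)
import Algebra.Properties.CommutativeMonoid.Mult as Mult
import Algebra.Properties.CommutativeSemigroup as CommutativeSemigroupProperties
import Algebra.Properties.Group as GroupProperties
import Algebra.Properties.Ring as RingProperties
import Algebra.Properties.Semiring.Exp as SemiringExp
import Algebra.Properties.Semiring.Mult as SemiringMult
open import Axiom.ExcludedMiddle using (ExcludedMiddle)
open import Data.Integer.Base as ℤ using (ℤ; -[1+_])
open import Data.Nat.Base as ℕ using (ℕ)
open import Data.Nat.Induction using (<-rec)
import Data.Nat.Properties as ℕ
open import Data.Product.Base using (Σ; Σ-syntax; ∃-syntax; _×_; _,_; proj₁; proj₂)
open import Data.Rational.Base as ℚ using (ℚ)
open import Data.Sum.Base using (_⊎_; inj₁; inj₂)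
open import Data.Vec.Base using (_∷_; []; _∷ʳ_; replicate)
open import Function.Base using (_on_)
open import Level using (suc; Lift; lift; lower)
open import Relation.Binary.Bundles using (Poset; StrictTotalOrder)
import Relation.Binary.Construct.On as On
import Relation.Binary.Construct.StrictToNonStrict as StrictToNonStrict
open import Relation.Binary.Core using (Rel)
open import Relation.Binary.Definitions using (Transitive; tri<; tri≈; tri>; _Respects_)
open import Relation.Binary.PropositionalEquality.Core as ≡ using (_≡_)
import Relation.Binary.Properties.StrictTotalOrder as StrictTotalOrderProperties
import Relation.Binary.Reasoning.Setoid as SetoidReasoning
import Relation.Binary.Reasoning.StrictPartialOrder as StrictPartialOrderReasoning
open import Relation.Binary.Structures using (IsStrictTotalOrder)
open import Relation.Nullary.Decidable.Core using (yes; no; True; toWitness; fromWitness)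
open import Relation.Nullary.Negation.Core using (¬_; contradiction)
open import Relation.Unary using (Pred; _∈_; _⊆_)

-- `E` speaks only about the non-negative cone, so a negative integer has no power of its own.
-- Powers therefore stay a relation on the cone, and differences of exponents are matched with
-- quotients of powers. Quotient groups are never formed. Both are represented by preorders on the
-- groups themselves, comparison up to a finite summand and comparison up to a finite factor, and
-- these absorb all rounding errors. The lifting preserves the strict order because two distinct
-- elements of a complement differ by more than any element of the convex subgroup, so they are
-- ordered as their classes are. In the Zorn argument the candidates are subgroups that are closed
-- under roots and meet the convex subgroup trivially. A maximal one spans because the group is
-- divisible and its quotient by the convex subgroup is torsion-free: a class that is missed could
-- be adjoined together with all its roots.

-- Abelian groups ordered modulo a convex subgroup

-- The preorder _≾_ encodes a convex subgroup, namely {x | x ≋ ε}.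
record CoarselyOrderedGroup ℓ : Set (suc ℓ) where
  infix 4 _<_ _≾_ _≋_
  field
    abelianGroup : AbelianGroup ℓ ℓ
  open AbelianGroup abelianGroup public
  open Mult commutativeMonoid public
    using (×-congʳ; ×-congˡ; ×-homo-+; ×-assocˡ; ×-distrib-+)
    renaming (_×_ to _ⁿ·_)
  open CommutativeSemigroupProperties commutativeSemigroup public
    using (interchange; xy∙z≈xz∙y)
  open GroupProperties group public
    using (inverseˡ-unique; ε⁻¹≈ε; x∙y⁻¹≈ε⇒x≈y)
  field
    _<_                : Rel Carrier ℓ
    isStrictTotalOrder : IsStrictTotalOrder _≈_ _<_
    ∙-monoˡ-<          : ∀ z {x y} → x < y → x ∙ z < y ∙ z
    _≾_                : Rel Carrier ℓ
    ≾-trans            : Transitive _≾_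
    ≾-reflexive        : ∀ {x y} → x ≈ y → x ≾ y
    <⇒≾                : ∀ {x y} → x < y → x ≾ y
    ∙-monoˡ-≾          : ∀ z {x y} → x ≾ y → x ∙ z ≾ y ∙ z
    divisible          : ∀ n x → ∃[ y ] ℕ.suc n ⁿ· y ≈ x

  open IsStrictTotalOrder isStrictTotalOrder public
    using (compare; irrefl; <-respˡ-≈; <-respʳ-≈)
    renaming (trans to <-trans)

  _≋_ : Rel Carrier ℓ
  x ≋ y = x ≾ y × y ≾ x

  ≋-sym : ∀ {x y} → x ≋ y → y ≋ x
  ≋-sym (p , q) = q , p

  ≋-trans : ∀ {x y z} → x ≋ y → y ≋ z → x ≋ z
  ≋-trans (p , q) (p′ , q′) = ≾-trans p p′ , ≾-trans q′ q

  ≋-reflexive : ∀ {x y} → x ≈ y → x ≋ y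
  ≋-reflexive x≈y = ≾-reflexive x≈y , ≾-reflexive (sym x≈y)

  ∙-mono-≾ : ∀ {x y z w} → x ≾ y → z ≾ w → x ∙ z ≾ y ∙ w
  ∙-mono-≾ {x} {y} {z} {w} x≾y z≾w =
    ≾-trans (∙-monoˡ-≾ z x≾y)
    (≾-trans (≾-reflexive (comm y z))
    (≾-trans (∙-monoˡ-≾ y z≾w)
    (≾-reflexive (comm w y))))

  ∙-cong-≋ : ∀ {x y z w} → x ≋ y → z ≋ w → x ∙ z ≋ y ∙ w
  ∙-cong-≋ (p , q) (p′ , q′) = ∙-mono-≾ p p′ , ∙-mono-≾ q q′

  x∙z∙z⁻¹≈x : ∀ x z → x ∙ z ∙ z ⁻¹ ≈ x
  x∙z∙z⁻¹≈x x z = trans (assoc x z (z ⁻¹)) (trans (∙-congˡ (inverseʳ z)) (identityʳ x))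

  x∙z⁻¹∙z≈x : ∀ x z → x ∙ z ⁻¹ ∙ z ≈ x
  x∙z⁻¹∙z≈x x z = trans (assoc x (z ⁻¹) z) (trans (∙-congˡ (inverseˡ z)) (identityʳ x))

  ∙-cancelʳ-≾ : ∀ z {x y} → x ∙ z ≾ y ∙ z → x ≾ y
  ∙-cancelʳ-≾ z {x} {y} xz≾yz =
    ≾-trans (≾-reflexive (sym (x∙z∙z⁻¹≈x x z)))
    (≾-trans (∙-monoˡ-≾ (z ⁻¹) xz≾yz)
    (≾-reflexive (x∙z∙z⁻¹≈x y z)))

  ∙-cancelʳ-≋ : ∀ z {x y} → x ∙ z ≋ y ∙ z → x ≋ y
  ∙-cancelʳ-≋ z (p , q) = ∙-cancelʳ-≾ z p , ∙-cancelʳ-≾ z q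

  ≋⇒∙⁻¹≋ε : ∀ {x y} → x ≋ y → x ∙ y ⁻¹ ≋ ε
  ≋⇒∙⁻¹≋ε {x} {y} x≋y = ≋-trans (∙-cong-≋ x≋y (≋-reflexive refl)) (≋-reflexive (inverseʳ y))

  ⁻¹-≋ε : ∀ {x} → x ≋ ε → x ⁻¹ ≋ ε
  ⁻¹-≋ε {x} x≋ε = ≋-trans (≋-reflexive (sym (identityˡ (x ⁻¹)))) (≋⇒∙⁻¹≋ε (≋-sym x≋ε))

  x⁻¹∙y≋z⇒x∙z≋y : ∀ x {y z} → x ⁻¹ ∙ y ≋ z → x ∙ z ≋ y
  x⁻¹∙y≋z⇒x∙z≋y x {y} x⁻¹y≋z = ≋-trans (∙-cong-≋ (≋-reflexive refl) (≋-sym x⁻¹y≋z))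
    (≋-reflexive (trans (sym (assoc x (x ⁻¹) y)) (trans (∙-congʳ (inverseʳ x)) (identityˡ y))))

  ⁿ·-≋ε : ∀ n {x} → x ≋ ε → n ⁿ· x ≋ ε
  ⁿ·-≋ε ℕ.zero    x≋ε = ≋-reflexive refl
  ⁿ·-≋ε (ℕ.suc n) x≋ε =
    ≋-trans (∙-cong-≋ x≋ε (ⁿ·-≋ε n x≋ε)) (≋-reflexive (identityˡ ε))

  ⁿ·-ε : ∀ n → n ⁿ· ε ≈ ε
  ⁿ·-ε ℕ.zero    = refl
  ⁿ·-ε (ℕ.suc n) = trans (identityˡ (n ⁿ· ε)) (ⁿ·-ε n)

  ⁿ·-⁻¹ : ∀ n x → n ⁿ· (x ⁻¹) ≈ (n ⁿ· x) ⁻¹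
  ⁿ·-⁻¹ n x = inverseˡ-unique (n ⁿ· (x ⁻¹)) (n ⁿ· x)
    (trans (sym (×-distrib-+ (x ⁻¹) x n)) (trans (×-congʳ n (inverseˡ x)) (ⁿ·-ε n)))

  ∙-mono-< : ∀ {x y z w} → x < y → z < w → x ∙ z < y ∙ w
  ∙-mono-< {x} {y} {z} {w} x<y z<w = <-trans (∙-monoˡ-< z x<y)
    (<-respˡ-≈ (comm z y) (<-respʳ-≈ (comm w y) (∙-monoˡ-< y z<w)))

  ⁿ·-pos : ∀ n {x} → ε < x → ε < ℕ.suc n ⁿ· x
  ⁿ·-pos ℕ.zero    {x} ε<x = <-respʳ-≈ (sym (identityʳ x)) ε<x
  ⁿ·-pos (ℕ.suc n)     ε<x = <-respˡ-≈ (identityˡ ε) (∙-mono-< ε<x (ⁿ·-pos n ε<x))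

  ⁿ·-neg : ∀ n {x} → x < ε → ℕ.suc n ⁿ· x < ε
  ⁿ·-neg ℕ.zero    {x} x<ε = <-respˡ-≈ (sym (identityʳ x)) x<ε
  ⁿ·-neg (ℕ.suc n)     x<ε = <-respʳ-≈ (identityˡ ε) (∙-mono-< x<ε (ⁿ·-neg n x<ε))

  torsionFree : ∀ n {x} → ℕ.suc n ⁿ· x ≈ ε → x ≈ ε
  torsionFree n {x} nx≈ε with compare x ε
  ... | tri< x<ε _ _ = contradiction (ⁿ·-neg n x<ε) (irrefl nx≈ε)
  ... | tri≈ _ x≈ε _ = x≈ε
  ... | tri> _ _ ε<x = contradiction (ⁿ·-pos n ε<x) (irrefl (sym nx≈ε))

  ε≾ⁿ· : ∀ n {x} → ε < x → ε ≾ n ⁿ· x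
  ε≾ⁿ· ℕ.zero    ε<x = ≾-reflexive refl
  ε≾ⁿ· (ℕ.suc n) ε<x = <⇒≾ (ⁿ·-pos n ε<x)

  -- The quotient by the convex subgroup is ordered, hence torsion-free: a positive `x` lies below
  -- its own multiples.
  ⁿ·≾ε⇒≾ε : ∀ n {x} → ℕ.suc n ⁿ· x ≾ ε → x ≾ ε
  ⁿ·≾ε⇒≾ε n {x} nx≾ε with compare x ε
  ... | tri< x<ε _ _ = <⇒≾ x<ε
  ... | tri≈ _ x≈ε _ = ≾-reflexive x≈ε
  ... | tri> _ _ ε<x =
    ≾-trans (≾-trans (≾-reflexive (sym (identityʳ x))) (∙-mono-≾ (≾-reflexive refl) (ε≾ⁿ· n ε<x))) nx≾ε

  ⁿ·≋ε⇒≋ε : ∀ n {x} → ℕ.suc n ⁿ· x ≋ ε → x ≋ ε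
  ⁿ·≋ε⇒≋ε n {x} nx≋ε = ⁿ·≾ε⇒≾ε n (proj₁ nx≋ε) , ε≾x
    where
    x⁻¹≾ε : x ⁻¹ ≾ ε
    x⁻¹≾ε = ⁿ·≾ε⇒≾ε n (proj₁ (≋-trans (≋-reflexive (ⁿ·-⁻¹ (ℕ.suc n) x)) (⁻¹-≋ε nx≋ε)))
    ε≾x : ε ≾ x
    ε≾x = ≾-trans (≾-reflexive (sym (inverseˡ x)))
      (≾-trans (∙-monoˡ-≾ x x⁻¹≾ε) (≾-reflexive (identityˡ x)))

  -- Compares b = p q⁻¹ with b′ = p′ q′⁻¹ up to _≋_ by cross-multiplication.
  module _ {b b′ p p′ q q′} (bq≋p : b ∙ q ≋ p) (b′q′≋p′ : b′ ∙ q′ ≋ p′) where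

    private
      pq′≋bqq′ : p ∙ q′ ≋ b ∙ (q ∙ q′)
      pq′≋bqq′ = ≋-trans (∙-cong-≋ (≋-sym bq≋p) (≋-reflexive refl)) (≋-reflexive (assoc b q q′))

      p′q≋b′qq′ : p′ ∙ q ≋ b′ ∙ (q ∙ q′)
      p′q≋b′qq′ = ≋-trans (∙-cong-≋ (≋-sym b′q′≋p′) (≋-reflexive refl))
        (≋-reflexive (trans (xy∙z≈xz∙y b′ q′ q) (assoc b′ q q′)))

    quotient-≾ : p ∙ q′ ≾ p′ ∙ q → b ≾ b′
    quotient-≾ pq′≾p′q = ∙-cancelʳ-≾ (q ∙ q′)
      (≾-trans (proj₂ pq′≋bqq′) (≾-trans pq′≾p′q (proj₁ p′q≋b′qq′)))

    quotient-≾⁻¹ : b ≾ b′ → p ∙ q′ ≾ p′ ∙ q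
    quotient-≾⁻¹ b≾b′ =
      ≾-trans (proj₁ pq′≋bqq′) (≾-trans (∙-monoˡ-≾ (q ∙ q′) b≾b′) (proj₂ p′q≋b′qq′))

-- Complements from Zorn's lemma

module _ {ℓ} (G : CoarselyOrderedGroup ℓ) where
  open CoarselyOrderedGroup G

  record IsSubgroup (A : Pred Carrier ℓ) : Set ℓ where
    field
      resp : A Respects _≈_
      ε∈   : ε ∈ A
      ∙-∈  : ∀ {x y} → x ∈ A → y ∈ A → x ∙ y ∈ A
      ⁻¹-∈ : ∀ {x} → x ∈ A → x ⁻¹ ∈ A

    ⁿ·-∈ : ∀ n {x} → x ∈ A → n ⁿ· x ∈ A
    ⁿ·-∈ ℕ.zero    x∈ = ε∈
    ⁿ·-∈ (ℕ.suc n) x∈ = ∙-∈ x∈ (ⁿ·-∈ n x∈)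

    ᶻ·-∈ : ∀ i {x} → x ∈ A → _ᶻ·_ abelianGroup i x ∈ A
    ᶻ·-∈ (ℤ.+ n)  x∈ = ⁿ·-∈ n x∈
    ᶻ·-∈ -[1+ n ] x∈ = ⁻¹-∈ (ⁿ·-∈ (ℕ.suc n) x∈)

  -- In a divisible torsion-free group these are exactly the `ℚ`-subspaces; the form with roots
  -- keeps rational numbers out of the Zorn argument.
  record IsIsolated (A : Pred Carrier ℓ) : Set ℓ where
    field
      isSubgroup : IsSubgroup A
      root-∈     : ∀ n {x} → ℕ.suc n ⁿ· x ∈ A → x ∈ A
    open IsSubgroup isSubgroup public

    isℚSubspace : IsℚSubspace abelianGroup A
    isℚSubspace = record
      { resp = resp
      ; ε∈   = ε∈
      ; ∙-∈  = ∙-∈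
      ; ⁻¹-∈ = ⁻¹-∈
      ; ℚ-∈  = λ q x∈ qx≈y → root-∈ (ℚ.denominator-1 q) (resp (sym qx≈y) (ᶻ·-∈ (ℚ.↥ q) x∈))
      }

  -- A partial transversal: each class of `_≋_` contains at most one of its elements, and some
  -- classes may be missed.
  record Transversal (A : Pred Carrier ℓ) : Set ℓ where
    field
      isIsolated : IsIsolated A
      disjoint   : ∀ {x} → x ∈ A → x ≋ ε → x ≈ ε
    open IsIsolated isIsolated public

    ≋⇒≈ : ∀ {x y} → x ∈ A → y ∈ A → x ≋ y → x ≈ y
    ≋⇒≈ {x} {y} x∈ y∈ x≋y = x∙y⁻¹≈ε⇒x≈y x y (disjoint (∙-∈ x∈ (⁻¹-∈ y∈)) (≋⇒∙⁻¹≋ε x≋y))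

  record SpanningTransversal : Set (suc ℓ) where
    field
      A           : Pred Carrier ℓ
      transversal : Transversal A
      spanning    : ∀ x → ∃[ a ] (a ∈ A × x ≋ a)
    open Transversal transversal public

    complement : ∀ {W : Pred Carrier ℓ} → (∀ {x} → x ∈ W → x ≋ ε) → (∀ {x} → x ≋ ε → x ∈ W) →
                 Complement abelianGroup W
    complement W⇒≋ε ≋ε⇒W = record
      { A           = A
      ; isℚSubspace = isℚSubspace
      ; disjoint    = λ x∈A x∈W → disjoint x∈A (W⇒≋ε x∈W)
      ; spanning    = λ x → let a , a∈ , x≋a = spanning x in
          a , a ⁻¹ ∙ x , a∈ , ≋ε⇒W (≋-trans (≋-reflexive (comm (a ⁻¹) x)) (≋⇒∙⁻¹≋ε x≋a)) ,
          sym (trans (sym (assoc a (a ⁻¹) x)) (trans (∙-congʳ (inverseʳ a)) (identityˡ x)))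
      }

  -- For a subgroup `A` this is its `ℚ`-span, described by clearing denominators.
  IsolatedHull : Pred Carrier ℓ → Pred Carrier ℓ
  IsolatedHull A z = ∃[ m ] ℕ.suc m ⁿ· z ∈ A

  isolatedHull-isIsolated : ∀ {A} → IsSubgroup A → IsIsolated (IsolatedHull A)
  isolatedHull-isIsolated {A} isSubgroup = record
    { isSubgroup = record
      { resp = λ x≈y (m , mx∈) → m , resp (×-congʳ (ℕ.suc m) x≈y) mx∈
      ; ε∈   = 0 , resp (sym (identityʳ ε)) ε∈
      -- The witness is the predecessor of `suc m * suc n`, a common multiple of both denominators.
      ; ∙-∈  = λ {x} {y} (m , mx∈) (n , ny∈) → n ℕ.+ m ℕ.* ℕ.suc n ,
          resp (sym (×-distrib-+ x y (ℕ.suc m ℕ.* ℕ.suc n)))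
            (∙-∈ (resp (trans (×-assocˡ x (ℕ.suc n) (ℕ.suc m))
                              (×-congˡ (ℕ.*-comm (ℕ.suc n) (ℕ.suc m))))
                       (ⁿ·-∈ (ℕ.suc n) mx∈))
                 (resp (×-assocˡ y (ℕ.suc m) (ℕ.suc n)) (ⁿ·-∈ (ℕ.suc m) ny∈)))
      ; ⁻¹-∈ = λ {x} (m , mx∈) → m , resp (sym (ⁿ·-⁻¹ (ℕ.suc m) x)) (⁻¹-∈ mx∈)
      }
    ; root-∈ = λ n {x} (m , mnx∈) → n ℕ.+ m ℕ.* ℕ.suc n , resp (×-assocˡ x (ℕ.suc m) (ℕ.suc n)) mnx∈
    }
    where open IsSubgroup isSubgroup

  -- The subgroup generated by A and x; two natural numbers stand for the
  -- integer multiple l - k of x.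
  Adjoin : Pred Carrier ℓ → Carrier → Pred Carrier ℓ
  Adjoin A x c = ∃[ k ] ∃[ l ] ∃[ a ] (a ∈ A × c ∙ k ⁿ· x ≈ a ∙ l ⁿ· x)

  adjoin-isSubgroup : ∀ {A} x → IsSubgroup A → IsSubgroup (Adjoin A x)
  adjoin-isSubgroup {A} x isSubgroup = record
    { resp = λ c≈d (k , l , a , a∈ , eq) → k , l , a , a∈ , trans (∙-congʳ (sym c≈d)) eq
    ; ε∈   = 0 , 0 , ε , ε∈ , refl
    ; ∙-∈  = λ {c} {d} (k , l , a , a∈ , eq) (k′ , l′ , a′ , a′∈ , eq′) →
        k ℕ.+ k′ , l ℕ.+ l′ , a ∙ a′ , ∙-∈ a∈ a′∈ ,
        trans (∙-congˡ (×-homo-+ x k k′))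
        (trans (interchange c d (k ⁿ· x) (k′ ⁿ· x))
        (trans (∙-cong eq eq′)
        (trans (interchange a (l ⁿ· x) a′ (l′ ⁿ· x))
        (∙-congˡ (sym (×-homo-+ x l l′))))))
    ; ⁻¹-∈ = λ {c} (k , l , a , a∈ , eq) → l , k , a ⁻¹ , ⁻¹-∈ a∈ , swap c a (k ⁿ· x) (l ⁿ· x) eq
    }
    where
    open IsSubgroup isSubgroup
    swap : ∀ c a u v → c ∙ u ≈ a ∙ v → c ⁻¹ ∙ v ≈ a ⁻¹ ∙ u
    swap c a u v eq = begin
      c ⁻¹ ∙ v                  ≈⟨ x∙z∙z⁻¹≈x (c ⁻¹ ∙ v) a ⟨
      c ⁻¹ ∙ v ∙ a ∙ a ⁻¹       ≈⟨ ∙-congʳ (assoc (c ⁻¹) v a) ⟩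
      c ⁻¹ ∙ (v ∙ a) ∙ a ⁻¹     ≈⟨ ∙-congʳ (∙-congˡ (trans (comm v a) (sym eq))) ⟩
      c ⁻¹ ∙ (c ∙ u) ∙ a ⁻¹     ≈⟨ ∙-congʳ (assoc (c ⁻¹) c u) ⟨
      c ⁻¹ ∙ c ∙ u ∙ a ⁻¹       ≈⟨ ∙-congʳ (trans (∙-congʳ (inverseˡ c)) (identityˡ u)) ⟩
      u ∙ a ⁻¹                  ≈⟨ comm u (a ⁻¹) ⟩
      a ⁻¹ ∙ u                  ∎
      where open SetoidReasoning setoid

  -- The root of `a` exists by divisibility and stays in `A` by isolation. It agrees with `x` up to
  -- `_≋_` because the quotient is torsion-free.
  root-spanned : ∀ {A} → IsIsolated A → ∀ n {x a} → a ∈ A → ℕ.suc n ⁿ· x ≋ a →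
                 ∃[ b ] (b ∈ A × x ≋ b)
  root-spanned isIsolated n {x} {a} a∈ nx≋a with divisible n a
  ... | b , nb≈a = b , root-∈ n (resp (sym nb≈a) a∈) , x≋b
    where
    open IsIsolated isIsolated
    x≋b : x ≋ b
    x≋b = ∙-cancelʳ-≋ (b ⁻¹) (≋-trans (ⁿ·≋ε⇒≋ε n (≋-trans (≋-reflexive
      (trans (×-distrib-+ x (b ⁻¹) (ℕ.suc n)) (∙-congˡ (trans (ⁿ·-⁻¹ (ℕ.suc n) b) (⁻¹-cong nb≈a)))))
      (≋⇒∙⁻¹≋ε nx≋a))) (≋-reflexive (sym (inverseʳ b))))

  -- Suppose `c` is trivial modulo `_≋_` and equals `a` times an integer power of `x`. If the
  -- exponent is non-zero, a power of `x` is congruent to an element of `A`, and by `root-spanned`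
  -- so is `x`. If it is zero, `c` already lies in `A`.
  adjoin-transversal : ∀ {A} → Transversal A → ∀ {x} → ¬ (∃[ a ] (a ∈ A × x ≋ a)) →
                       Transversal (IsolatedHull (Adjoin A x))
  adjoin-transversal {A} transversal {x} ∄a = record
    { isIsolated = isolatedHull-isIsolated (adjoin-isSubgroup x isSubgroup)
    ; disjoint   = λ (m , k , l , a , a∈ , eq) z≋ε →
        torsionFree m (trivial k l a∈ (ⁿ·-≋ε (ℕ.suc m) z≋ε) eq)
    }
    where
    open Transversal transversal
    trivial : ∀ k l {a c} → a ∈ A → c ≋ ε → c ∙ k ⁿ· x ≈ a ∙ l ⁿ· x → c ≈ ε
    trivial ℕ.zero ℕ.zero {a} {c} a∈ c≋ε eq = disjoint (resp (sym c≈a) a∈) c≋ε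
      where
      c≈a : c ≈ a
      c≈a = trans (sym (identityʳ c)) (trans eq (identityʳ a))
    trivial ℕ.zero (ℕ.suc l) {a} {c} a∈ c≋ε eq = contradiction
      (root-spanned isIsolated l (⁻¹-∈ a∈) (∙-cancelʳ-≋ a
        (≋-trans (≋-reflexive (trans (comm (ℕ.suc l ⁿ· x) a) (trans (sym eq) (identityʳ c))))
        (≋-trans c≋ε (≋-reflexive (sym (inverseˡ a))))))) ∄a
    trivial (ℕ.suc k) ℕ.zero {a} {c} a∈ c≋ε eq = contradiction
      (root-spanned isIsolated k a∈
        (≋-trans (≋-reflexive (sym (identityˡ (ℕ.suc k ⁿ· x))))
        (≋-trans (∙-cong-≋ (≋-sym c≋ε) (≋-reflexive refl))
        (≋-reflexive (trans eq (identityʳ a)))))) ∄a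
    -- One `x` is cancelled on both sides until one of the two exponents vanishes.
    trivial (ℕ.suc k) (ℕ.suc l) {a} {c} a∈ c≋ε eq = trivial k l a∈ c≋ε
      (trans (sym (x∙z∙z⁻¹≈x (c ∙ k ⁿ· x) x))
      (trans (∙-congʳ (trans (assoc c (k ⁿ· x) x) (trans (∙-congˡ (comm (k ⁿ· x) x))
        (trans eq (trans (∙-congˡ (comm x (l ⁿ· x))) (sym (assoc a (l ⁿ· x) x)))))))
      (x∙z∙z⁻¹≈x (a ∙ l ⁿ· x) x)))

  record Transversals : Set (suc ℓ) where
    field
      A           : Pred Carrier ℓ
      transversal : Transversal A
    open Transversal transversal public

  open Transversals using (A)

  transversals : Poset (suc ℓ) ℓ ℓ
  transversals = record
    { Carrier = Transversals
    ; _≈_ = λ S T → A S ⊆ A T × A T ⊆ A S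
    ; _≤_ = λ S T → A S ⊆ A T
    ; isPartialOrder = record
      { isPreorder = record
        { isEquivalence = record
          { refl  = (λ z → z) , (λ z → z)
          ; sym   = λ (p , q) → q , p
          ; trans = λ (p , q) (p′ , q′) → (λ z → p′ (p z)) , (λ z → q (q′ z))
          }
        ; reflexive = proj₁
        ; trans     = λ p q z → q (p z)
        }
      ; antisym = _,_
      }
    }

  zeroTransversal : Transversals
  zeroTransversal = record
    { A = _≈ ε
    ; transversal = record
      { isIsolated = record
        { isSubgroup = record
          { resp = λ x≈y x≈ε → trans (sym x≈y) x≈ε
          ; ε∈   = refl
          ; ∙-∈  = λ x≈ε y≈ε → trans (∙-cong x≈ε y≈ε) (identityˡ ε)
          ; ⁻¹-∈ = λ x≈ε → trans (⁻¹-cong x≈ε) ε⁻¹≈ε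
          }
        ; root-∈ = torsionFree
        }
      ; disjoint = λ x≈ε _ → x≈ε
      }
    }

  module _ (em : ∀ {a} → ExcludedMiddle a) where

    -- The union of a chain of predicates lives in a higher universe;
    -- excluded middle brings it back. Adding the zero subgroup covers the
    -- empty chain.
    ChainUnion : Pred Transversals ℓ → Pred Carrier ℓ
    ChainUnion C x = Lift ℓ (True (em {P = ∃[ S ] ((S ∈ C ⊎ S ≡ zeroTransversal) × x ∈ A S)}))

    module _ (C : Pred Transversals ℓ)
             (chain : ∀ {S T} → S ∈ C → T ∈ C → A S ⊆ A T ⊎ A T ⊆ A S) where
      open Transversals hiding (A)

      private
        C₀ : Pred Transversals (suc ℓ)
        C₀ S = S ∈ C ⊎ S ≡ zeroTransversal

        chain₀ : ∀ {S T} → S ∈ C₀ → T ∈ C₀ → A S ⊆ A T ⊎ A T ⊆ A S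
        chain₀         (inj₁ S∈)     (inj₁ T∈)     = chain S∈ T∈
        chain₀ {S}     (inj₁ _)      (inj₂ ≡.refl) = inj₂ λ x≈ε → resp S (sym x≈ε) (ε∈ S)
        chain₀ {_} {T} (inj₂ ≡.refl) _             = inj₁ λ x≈ε → resp T (sym x≈ε) (ε∈ T)

        into : ∀ {S} → S ∈ C₀ → A S ⊆ ChainUnion C
        into {S} S∈ x∈ = lift (fromWitness (S , S∈ , x∈))

        out : ∀ {x} → x ∈ ChainUnion C → ∃[ S ] (S ∈ C₀ × x ∈ A S)
        out x∈ = toWitness (lower x∈)

        out₂ : ∀ {x y} → x ∈ ChainUnion C → y ∈ ChainUnion C →
               ∃[ S ] (S ∈ C₀ × x ∈ A S × y ∈ A S)
        out₂ x∈ y∈ with out x∈ | out y∈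
        ... | S , S∈ , x∈S | T , T∈ , y∈T with chain₀ S∈ T∈
        ...   | inj₁ S⊆T = T , T∈ , S⊆T x∈S , y∈T
        ...   | inj₂ T⊆S = S , S∈ , x∈S , T⊆S y∈T

      chainUnion-isIsolated : IsIsolated (ChainUnion C)
      chainUnion-isIsolated = record
        { isSubgroup = record
          { resp = λ x≈y x∈ → let S , S∈ , x∈S = out x∈ in into S∈ (resp S x≈y x∈S)
          ; ε∈   = into (inj₂ ≡.refl) refl
          ; ∙-∈  = λ x∈ y∈ → let S , S∈ , x∈S , y∈S = out₂ x∈ y∈ in into S∈ (∙-∈ S x∈S y∈S)
          ; ⁻¹-∈ = λ x∈ → let S , S∈ , x∈S = out x∈ in into S∈ (⁻¹-∈ S x∈S)
          }
        ; root-∈ = λ n nx∈ → let S , S∈ , nx∈S = out nx∈ in into S∈ (root-∈ S n nx∈S)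
        }

      chainUnion : ∃[ U ] (∀ {S} → S ∈ C → A S ⊆ A U)
      chainUnion = record
        { A = ChainUnion C
        ; transversal = record
          { isIsolated = chainUnion-isIsolated
          ; disjoint   = λ x∈ x≋ε → let S , _ , x∈S = out x∈ in disjoint S x∈S x≋ε
          }
        } , λ S∈ → into (inj₁ S∈)

    spanningTransversal : ZornsLemma (suc ℓ) ℓ ℓ ℓ → SpanningTransversal
    spanningTransversal zorn with zorn transversals chainUnion
    ... | S , maximal = record { transversal = transversal; spanning = spanning }
      where
      open Transversals S using (transversal; ε∈)
      spanning : ∀ x → ∃[ a ] (a ∈ A S × x ≋ a)
      spanning x with em {P = ∃[ a ] (a ∈ A S × x ≋ a)}
      ... | yes ∃a = ∃a
      -- No contradiction is drawn from `∄a` here: maximality puts `x` itself into `A S`, where it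
      -- represents its own class.
      ... | no  ∄a = x , proj₁ (maximal {T} S⊆T) x∈T , ≋-reflexive refl
        where
        T : Transversals
        T = record { transversal = adjoin-transversal transversal ∄a }
        S⊆T : A S ⊆ A T
        S⊆T {a} a∈ = 0 , 0 , 0 , a , a∈ , ∙-congʳ (identityʳ a)
        x∈T : x ∈ A T
        x∈T = 0 , 0 , 1 , ε , ε∈ , trans (identityʳ _) (sym (identityˡ _))

-- Lifting an isomorphism of quotients to transversals

module _ {ℓ} {G H : CoarselyOrderedGroup ℓ} where
  private
    module G = CoarselyOrderedGroup G
    module H = CoarselyOrderedGroup H

  -- P induces an isomorphism between the quotients of G and H by {x | x ≋ ε}.
  record CoarseIsomorphism : Set (suc ℓ) where
    field
      P       : G.Carrier → H.Carrier → Set ℓ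
      P-∙     : ∀ {x y p q} → P x p → P y q → P (x G.∙ y) (p H.∙ q)
      P-≾     : ∀ {x y p q} → P x p → P y q → x G.≾ y → p H.≾ q
      P-≾⁻¹   : ∀ {x y p q} → P x p → P y q → p H.≾ q → x G.≾ y
      total   : ∀ a → ∃[ x ] ∃[ y ] ∃[ p ] ∃[ q ] (P x p × P y q × a G.∙ y G.≋ x)
      onto    : ∀ b → ∃[ x ] ∃[ y ] ∃[ p ] ∃[ q ] (P x p × P y q × b H.∙ q H.≋ p)

    -- `P` need not be closed under inverses. This is its extension to differences and quotients, as
    -- in passing from a cancellative monoid to its group of fractions.
    _↝_ : G.Carrier → H.Carrier → Set ℓ
    a ↝ b = ∃[ x ] ∃[ y ] ∃[ p ] ∃[ q ] (P x p × P y q × a G.∙ y G.≋ x × b H.∙ q H.≋ p)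

    ↝-total : ∀ a → ∃[ b ] a ↝ b
    ↝-total a = let x , y , p , q , Pxp , Pyq , ay≋x = total a in
      p H.∙ q H.⁻¹ , x , y , p , q , Pxp , Pyq , ay≋x , H.≋-reflexive (H.x∙z⁻¹∙z≈x p q)

    ↝-onto : ∀ b → ∃[ a ] a ↝ b
    ↝-onto b = let x , y , p , q , Pxp , Pyq , bq≋p = onto b in
      x G.∙ y G.⁻¹ , x , y , p , q , Pxp , Pyq , G.≋-reflexive (G.x∙z⁻¹∙z≈x x y) , bq≋p

    ↝-resp-≋ : ∀ {a a′ b b′} → a G.≋ a′ → b H.≋ b′ → a ↝ b → a′ ↝ b′
    ↝-resp-≋ a≋a′ b≋b′ (x , y , p , q , Pxp , Pyq , ay≋x , bq≋p) =
      x , y , p , q , Pxp , Pyq ,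
      G.≋-trans (G.∙-cong-≋ (G.≋-sym a≋a′) (G.≋-reflexive G.refl)) ay≋x ,
      H.≋-trans (H.∙-cong-≋ (H.≋-sym b≋b′) (H.≋-reflexive H.refl)) bq≋p

    ↝-∙ : ∀ {a a′ b b′} → a ↝ b → a′ ↝ b′ → (a G.∙ a′) ↝ (b H.∙ b′)
    ↝-∙ {a} {a′} {b} {b′} (x , y , p , q , Pxp , Pyq , ay≋x , bq≋p)
        (x′ , y′ , p′ , q′ , Px′p′ , Py′q′ , a′y′≋x′ , b′q′≋p′) =
      _ , _ , _ , _ , P-∙ Pxp Px′p′ , P-∙ Pyq Py′q′ ,
      G.≋-trans (G.≋-reflexive (G.interchange a a′ y y′)) (G.∙-cong-≋ ay≋x a′y′≋x′) ,
      H.≋-trans (H.≋-reflexive (H.interchange b b′ q q′)) (H.∙-cong-≋ bq≋p b′q′≋p′)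

    -- Cross-multiplication clears the denominators; the resulting products are again related by
    -- `P`, so `P-≾` compares them.
    ↝-≾ : ∀ {a a′ b b′} → a ↝ b → a′ ↝ b′ → a G.≾ a′ → b H.≾ b′
    ↝-≾ (_ , _ , _ , _ , Pxp , Pyq , ay≋x , bq≋p)
        (_ , _ , _ , _ , Px′p′ , Py′q′ , a′y′≋x′ , b′q′≋p′) a≾a′ =
      H.quotient-≾ bq≋p b′q′≋p′
        (P-≾ (P-∙ Pxp Py′q′) (P-∙ Px′p′ Pyq) (G.quotient-≾⁻¹ ay≋x a′y′≋x′ a≾a′))

    ↝-≾⁻¹ : ∀ {a a′ b b′} → a ↝ b → a′ ↝ b′ → b H.≾ b′ → a G.≾ a′
    ↝-≾⁻¹ (_ , _ , _ , _ , Pxp , Pyq , ay≋x , bq≋p)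
          (_ , _ , _ , _ , Px′p′ , Py′q′ , a′y′≋x′ , b′q′≋p′) b≾b′ =
      G.quotient-≾ ay≋x a′y′≋x′
        (P-≾⁻¹ (P-∙ Pxp Py′q′) (P-∙ Px′p′ Pyq) (H.quotient-≾⁻¹ bq≋p b′q′≋p′ b≾b′))

    ↝-≋ : ∀ {a a′ b b′} → a ↝ b → a′ ↝ b′ → a G.≋ a′ → b H.≋ b′
    ↝-≋ a↝b a′↝b′ (a≾a′ , a′≾a) = ↝-≾ a↝b a′↝b′ a≾a′ , ↝-≾ a′↝b′ a↝b a′≾a

    ↝-≋⁻¹ : ∀ {a a′ b b′} → a ↝ b → a′ ↝ b′ → b H.≋ b′ → a G.≋ a′
    ↝-≋⁻¹ a↝b a′↝b′ (b≾b′ , b′≾b) = ↝-≾⁻¹ a↝b a′↝b′ b≾b′ , ↝-≾⁻¹ a′↝b′ a↝b b′≾b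

  module _ (coarseIsomorphism : CoarseIsomorphism)
           (S : SpanningTransversal G) (T : SpanningTransversal H) where
    open CoarseIsomorphism coarseIsomorphism
    private
      module S = SpanningTransversal S
      module T = SpanningTransversal T
      module A = IsℚSubspace S.isℚSubspace
      module B = IsℚSubspace T.isℚSubspace
    open GroupMorphisms A.subgroup B.subgroup using (IsGroupIsomorphism)

    private
      exp∃ : ∀ a → ∃[ b ] (b ∈ T.A × a ↝ b)
      exp∃ a =
        let b , a↝b = ↝-total a
            b′ , b′∈ , b≋b′ = T.spanning b
        in b′ , b′∈ , ↝-resp-≋ (G.≋-reflexive G.refl) b≋b′ a↝b

    exp : Σ G.Carrier S.A → Σ H.Carrier T.A
    exp (a , _) = let b , b∈ , _ = exp∃ a in b , b∈

    exp-↝ : ∀ ((a , a∈) : Σ G.Carrier S.A) → a ↝ proj₁ (exp (a , a∈))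
    exp-↝ (a , _) = proj₂ (proj₂ (exp∃ a))

    -- The value of `exp` is chosen, but an element of `T.A` is determined by its class. Each law of
    -- `exp` thus reduces to the same law for `_↝_`.
    exp-unique : ∀ {a a′ b} (a∈ : a ∈ S.A) → b ∈ T.A → a′ ↝ b → a G.≋ a′ → proj₁ (exp (a , a∈)) H.≈ b
    exp-unique a∈ b∈ a′↝b a≋a′ =
      T.≋⇒≈ (proj₂ (exp (_ , a∈))) b∈ (↝-≋ (exp-↝ (_ , a∈)) a′↝b a≋a′)

    exp-isIsomorphism : IsGroupIsomorphism exp
    exp-isIsomorphism = record
      { isGroupMonomorphism = record
        { isGroupHomomorphism = record
          { isMonoidHomomorphism = record
            { isMagmaHomomorphism = record
              { isRelHomomorphism = record
                { cong = λ {(_ , a∈)} {y} a≈a′ →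
                    exp-unique a∈ (proj₂ (exp y)) (exp-↝ y) (G.≋-reflexive a≈a′) }
              ; homo = homo
              }
            ; ε-homo = ε-homo
            }
          ; ⁻¹-homo = λ x → H.inverseˡ-unique _ _
              (H.trans (H.sym (homo (_ , A.⁻¹-∈ (proj₂ x)) x))
              (H.trans (exp-unique (A.∙-∈ (A.⁻¹-∈ (proj₂ x)) (proj₂ x)) (proj₂ (exp ε₀)) (exp-↝ ε₀)
                         (G.≋-reflexive (G.inverseˡ (proj₁ x))))
              ε-homo))
          }
        ; injective = λ {x} {y} eq → S.≋⇒≈ (proj₂ x) (proj₂ y)
            (↝-≋⁻¹ (exp-↝ x) (exp-↝ y) (H.≋-reflexive eq))
        }
      ; surjective = λ (b , b∈) →
          let a , a↝b = ↝-onto b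
              a′ , a′∈ , a≋a′ = S.spanning a
          in (a′ , a′∈) , λ {(_ , z∈)} z≈a′ →
               exp-unique z∈ b∈ a↝b (G.≋-trans (G.≋-reflexive z≈a′) (G.≋-sym a≋a′))
      }
      where
      ε₀ : Σ G.Carrier S.A
      ε₀ = G.ε , A.ε∈
      homo : ∀ x y → proj₁ (exp (_ , A.∙-∈ (proj₂ x) (proj₂ y))) H.≈ proj₁ (exp x) H.∙ proj₁ (exp y)
      homo x y = exp-unique (A.∙-∈ (proj₂ x) (proj₂ y)) (B.∙-∈ (proj₂ (exp x)) (proj₂ (exp y)))
        (↝-∙ (exp-↝ x) (exp-↝ y)) (G.≋-reflexive G.refl)
      ε-homo : proj₁ (exp ε₀) H.≈ H.ε
      -- `exp ε₀` is idempotent, and cancelling one copy leaves the neutral element.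
      ε-homo = H.trans (H.sym (H.x∙z∙z⁻¹≈x (proj₁ (exp ε₀)) (proj₁ (exp ε₀))))
        (H.trans (H.∙-congʳ (H.trans (H.sym (homo ε₀ ε₀))
          (exp-unique (A.∙-∈ A.ε∈ A.ε∈) (proj₂ (exp ε₀)) (exp-↝ ε₀) (G.≋-reflexive (G.identityˡ G.ε)))))
        (H.inverseʳ (proj₁ (exp ε₀))))

    -- Only the coarse order is transported, so strictness comes from trichotomy: in the other two
    -- cases `x` and `y` share a class and would be equal.
    exp-mono-< : ∀ x y → proj₁ x G.< proj₁ y → proj₁ (exp x) H.< proj₁ (exp y)
    exp-mono-< x y x<y with H.compare (proj₁ (exp x)) (proj₁ (exp y))
    ... | tri< lt _ _ = lt
    ... | tri≈ _ eq _ = contradiction x<y (G.irrefl (S.≋⇒≈ (proj₂ x) (proj₂ y)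
      (↝-≋⁻¹ (exp-↝ x) (exp-↝ y) (H.≋-reflexive eq))))
    ... | tri> _ _ gt = contradiction x<y (G.irrefl (S.≋⇒≈ (proj₂ x) (proj₂ y)
      (G.<⇒≾ x<y , ↝-≾⁻¹ (exp-↝ y) (exp-↝ x) (H.<⇒≾ gt))))

-- Ordered rings and real closed fields

module OrderedRingProperties {ℓ} (D : OrderedRing ℓ) where
  open OrderedRing D
  open RingProperties ring using (-‿distribʳ-*; -‿involutive; x[y-z]≈xy-xz)
  open Mult +-commutativeMonoid using (×-congʳ; ×-congˡ; ×-homo-+; ×-assocˡ; ×-homo-1)
  open SemiringMult semiring using (×-comm-*; ×-assoc-*)

  strictTotalOrder : StrictTotalOrder ℓ ℓ ℓ
  strictTotalOrder = record { isStrictTotalOrder = isStrictTotalOrder }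

  open StrictToNonStrict _≈_ _<_ using () renaming (<-≤-trans to <-≤-trans′)
  open StrictTotalOrderProperties strictTotalOrder public
    using () renaming (trans to ≤-trans; total to ≤-total)
  module ≤-Reasoning =
    StrictPartialOrderReasoning (StrictTotalOrder.strictPartialOrder strictTotalOrder)

  <-≤-trans : ∀ {x y z} → x < y → y ≤ z → x < z
  <-≤-trans = <-≤-trans′ <-trans <-respʳ-≈

  ≤⇒≯ : ∀ {x y} → x ≤ y → ¬ y < x
  ≤⇒≯ (inj₁ x<y) y<x = irrefl refl (<-trans x<y y<x)
  ≤⇒≯ (inj₂ x≈y) y<x = irrefl (sym x≈y) y<x

  ≰⇒> : ∀ {x y} → ¬ x ≤ y → y < x
  ≰⇒> {x} {y} x≰y with compare x y
  ... | tri< x<y _ _ = contradiction (inj₁ x<y) x≰y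
  ... | tri≈ _ x≈y _ = contradiction (inj₂ x≈y) x≰y
  ... | tri> _ _ y<x = y<x

  +-monoʳ-< : ∀ z {x y} → x < y → z + x < z + y
  +-monoʳ-< z {x} {y} x<y = <-respˡ-≈ (+-comm x z) (<-respʳ-≈ (+-comm y z) (+-monoˡ-< z x<y))

  +-monoˡ-≤ : ∀ z {x y} → x ≤ y → x + z ≤ y + z
  +-monoˡ-≤ z (inj₁ x<y) = inj₁ (+-monoˡ-< z x<y)
  +-monoˡ-≤ z (inj₂ x≈y) = inj₂ (+-congʳ x≈y)

  +-monoʳ-≤ : ∀ z {x y} → x ≤ y → z + x ≤ z + y
  +-monoʳ-≤ z (inj₁ x<y) = inj₁ (+-monoʳ-< z x<y)
  +-monoʳ-≤ z (inj₂ x≈y) = inj₂ (+-congˡ x≈y)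

  +-mono-≤ : ∀ {x y z w} → x ≤ y → z ≤ w → x + z ≤ y + w
  +-mono-≤ {y = y} {z = z} x≤y z≤w = ≤-trans (+-monoˡ-≤ z x≤y) (+-monoʳ-≤ y z≤w)

  x<x+y : ∀ x {y} → 0# < y → x < x + y
  x<x+y x 0<y = <-respˡ-≈ (+-identityʳ x) (+-monoʳ-< x 0<y)

  x≤x+y : ∀ x {y} → 0# ≤ y → x ≤ x + y
  x≤x+y x (inj₁ 0<y) = inj₁ (x<x+y x 0<y)
  x≤x+y x (inj₂ 0≈y) = inj₂ (trans (sym (+-identityʳ x)) (+-congˡ 0≈y))

  x+y-y≈x : ∀ x y → x + y - y ≈ x
  x+y-y≈x x y = trans (+-assoc x y (- y)) (trans (+-congˡ (-‿inverseʳ y)) (+-identityʳ x))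

  +-cancelʳ-< : ∀ z {x y} → x + z < y + z → x < y
  +-cancelʳ-< z {x} {y} x+z<y+z =
    <-respˡ-≈ (x+y-y≈x x z) (<-respʳ-≈ (x+y-y≈x y z) (+-monoˡ-< (- z) x+z<y+z))

  x-y+y≈x : ∀ x y → x - y + y ≈ x
  x-y+y≈x x y = trans (+-assoc x (- y) y) (trans (+-congˡ (-‿inverseˡ y)) (+-identityʳ x))

  <⇒0<- : ∀ {x y} → x < y → 0# < y - x
  <⇒0<- {x} x<y = <-respˡ-≈ (-‿inverseʳ x) (+-monoˡ-< (- x) x<y)

  0<-⇒< : ∀ {x y} → 0# < y - x → x < y
  0<-⇒< {x} {y} 0<y-x = <-respˡ-≈ (+-identityˡ x) (<-respʳ-≈ (x-y+y≈x y x) (+-monoˡ-< x 0<y-x))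

  *-monoʳ-<-pos : ∀ {z} → 0# < z → ∀ {x y} → x < y → z * x < z * y
  *-monoʳ-<-pos {z} 0<z {x} {y} x<y =
    0<-⇒< (<-respʳ-≈ (x[y-z]≈xy-xz z y x) (*-pos 0<z (<⇒0<- x<y)))

  *-monoʳ-≤-pos : ∀ {z} → 0# < z → ∀ {x y} → x ≤ y → z * x ≤ z * y
  *-monoʳ-≤-pos 0<z (inj₁ x<y) = inj₁ (*-monoʳ-<-pos 0<z x<y)
  *-monoʳ-≤-pos 0<z (inj₂ x≈y) = inj₂ (*-congˡ x≈y)

  *-monoˡ-<-pos : ∀ {z} → 0# < z → ∀ {x y} → x < y → x * z < y * z
  *-monoˡ-<-pos {z} 0<z {x} {y} x<y =
    <-respˡ-≈ (*-comm z x) (<-respʳ-≈ (*-comm z y) (*-monoʳ-<-pos 0<z x<y))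

  *-cancelˡ-<-pos : ∀ {z} → 0# < z → ∀ {x y} → z * x < z * y → x < y
  *-cancelˡ-<-pos 0<z {x} {y} zx<zy with compare x y
  ... | tri< x<y _ _ = x<y
  ... | tri≈ _ x≈y _ = contradiction zx<zy (irrefl (*-congˡ x≈y))
  ... | tri> _ _ y<x = contradiction (<-trans zx<zy (*-monoʳ-<-pos 0<z y<x)) (irrefl refl)

  -x*-x≈x*x : ∀ x → - x * - x ≈ x * x
  -x*-x≈x*x x = trans (sym (-‿distribʳ-* (- x) x)) (trans (-‿cong (*-comm (- x) x))
    (trans (-‿cong (sym (-‿distribʳ-* x x))) (-‿involutive (x * x))))

  square-nonneg : ∀ x → 0# ≤ x * x
  square-nonneg x with compare 0# x
  ... | tri< 0<x _ _ = inj₁ (*-pos 0<x 0<x)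
  ... | tri≈ _ 0≈x _ = inj₂ (trans (sym (zeroˡ x)) (*-congʳ 0≈x))
  ... | tri> _ _ x<0 = inj₁ (<-respʳ-≈ (-x*-x≈x*x x) (*-pos (neg⇒pos x<0) (neg⇒pos x<0)))

  ·-nonneg : ∀ n {x} → 0# ≤ x → 0# ≤ n · x
  ·-nonneg ℕ.zero    0≤x = inj₂ refl
  ·-nonneg (ℕ.suc n) 0≤x = +-nonneg 0≤x (·-nonneg n 0≤x)

  suc·-pos : ∀ n {x} → 0# < x → 0# < ℕ.suc n · x
  suc·-pos n {x} 0<x with x≤x+y x (·-nonneg n (inj₁ 0<x))
  ... | inj₁ lt = <-trans 0<x lt
  ... | inj₂ eq = <-respʳ-≈ eq 0<x

  ·-mono-≤ : ∀ n {x y} → x ≤ y → n · x ≤ n · y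
  ·-mono-≤ ℕ.zero    x≤y = inj₂ refl
  ·-mono-≤ (ℕ.suc n) x≤y = +-mono-≤ x≤y (·-mono-≤ n x≤y)

  ·-monoˡ-≤ : ∀ m n {x} → 0# ≤ x → m · x ≤ (m ℕ.+ n) · x
  ·-monoˡ-≤ m n {x} 0≤x = ≤-trans (x≤x+y (m · x) (·-nonneg n 0≤x)) (inj₂ (sym (×-homo-+ x m n)))

  infix 4 _≲₊_ _≲_

  -- These are the orders of R/R_v and, for positive elements, of R^{>0}/U_v^{>0}, pulled back to
  -- representatives. For positive `x` and `y` the second one says v(y) ≤ v(x).
  _≲₊_ _≲_ : Rel Carrier ℓ
  x ≲₊ y = ∃[ n ] x ≤ y + n · 1#
  x ≲  y = ∃[ n ] x ≤ n · y

  ≤⇒≲₊ : ∀ {x y} → x ≤ y → x ≲₊ y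
  ≤⇒≲₊ {y = y} x≤y = 0 , ≤-trans x≤y (inj₂ (sym (+-identityʳ y)))

  ≲₊-trans : Transitive _≲₊_
  ≲₊-trans {x} {y} {z} (m , x≤y+m) (n , y≤z+n) = n ℕ.+ m , (begin
    x                      ≤⟨ x≤y+m ⟩
    y + m · 1#             ≤⟨ +-monoˡ-≤ (m · 1#) y≤z+n ⟩
    z + n · 1# + m · 1#    ≈⟨ +-assoc z (n · 1#) (m · 1#) ⟩
    z + (n · 1# + m · 1#)  ≈⟨ +-congˡ (×-homo-+ 1# n m) ⟨
    z + (n ℕ.+ m) · 1#     ∎)
    where open ≤-Reasoning

  +-monoˡ-≲₊ : ∀ z {x y} → x ≲₊ y → x + z ≲₊ y + z
  +-monoˡ-≲₊ z {x} {y} (n , x≤y+n) = n ,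
    ≤-trans (+-monoˡ-≤ z x≤y+n) (inj₂ (xy∙z≈xz∙y y (n · 1#) z))
    where open CommutativeSemigroupProperties +-commutativeSemigroup

  ≤⇒≲ : ∀ {x y} → x ≤ y → x ≲ y
  ≤⇒≲ {y = y} x≤y = 1 , ≤-trans x≤y (inj₂ (sym (×-homo-1 y)))

  ≲-trans : Transitive _≲_
  ≲-trans {x} {y} {z} (m , x≤my) (n , y≤nz) = m ℕ.* n , (begin
    x              ≤⟨ x≤my ⟩
    m · y          ≤⟨ ·-mono-≤ m y≤nz ⟩
    m · (n · z)    ≈⟨ ×-assocˡ z m n ⟩
    (m ℕ.* n) · z  ∎)
    where open ≤-Reasoning

  *-monoˡ-≲-pos : ∀ {z} → 0# < z → ∀ {x y} → x ≲ y → x * z ≲ y * z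
  *-monoˡ-≲-pos {z} 0<z {x} {y} (n , x≤ny) = n , (begin
    x * z        ≈⟨ *-comm x z ⟩
    z * x        ≤⟨ *-monoʳ-≤-pos 0<z x≤ny ⟩
    z * (n · y)  ≈⟨ *-comm z (n · y) ⟩
    n · y * z    ≈⟨ ×-assoc-* n y z ⟩
    n · (y * z)  ∎)
    where open ≤-Reasoning

  *-monoʳ-≲-pos : ∀ {z} → 0# < z → ∀ {x y} → x ≲ y → z * x ≲ z * y
  *-monoʳ-≲-pos {z} 0<z {x} {y} x≲y = ≲-trans (≤⇒≲ (inj₂ (*-comm z x)))
    (≲-trans (*-monoˡ-≲-pos 0<z x≲y) (≤⇒≲ (inj₂ (*-comm y z))))

  ∣x∣≈x∨-x : ∀ x → (∣ x ∣ ≈ x × 0# ≤ x) ⊎ (∣ x ∣ ≈ - x × x < 0#)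
  ∣x∣≈x∨-x x with compare x 0#
  ... | tri< x<0 _ _ = inj₂ (refl , x<0)
  ... | tri≈ _ x≈0 _ = inj₁ (refl , inj₂ (sym x≈0))
  ... | tri> _ _ 0<x = inj₁ (refl , inj₁ 0<x)

  0≤x⇒∣x∣≈x : ∀ {x} → 0# ≤ x → ∣ x ∣ ≈ x
  0≤x⇒∣x∣≈x {x} 0≤x with ∣x∣≈x∨-x x
  ... | inj₁ (eq , _)  = eq
  ... | inj₂ (_ , x<0) = contradiction x<0 (≤⇒≯ 0≤x)

  x≤∣x∣ : ∀ x → x ≤ ∣ x ∣
  x≤∣x∣ x with ∣x∣≈x∨-x x
  ... | inj₁ (eq , _)   = inj₂ (sym eq)
  ... | inj₂ (eq , x<0) = inj₁ (<-trans x<0 (<-respʳ-≈ (sym eq) (neg⇒pos x<0)))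

  0≤∣x∣ : ∀ x → 0# ≤ ∣ x ∣
  0≤∣x∣ x with ∣x∣≈x∨-x x
  ... | inj₁ (eq , 0≤x) = ≤-trans 0≤x (inj₂ (sym eq))
  ... | inj₂ (eq , x<0) = inj₁ (<-respʳ-≈ (sym eq) (neg⇒pos x<0))

  0≤x+∣x∣ : ∀ x → 0# ≤ x + ∣ x ∣
  0≤x+∣x∣ x with ∣x∣≈x∨-x x
  ... | inj₁ (eq , 0≤x) = ≤-trans (+-nonneg 0≤x 0≤x) (inj₂ (+-congˡ (sym eq)))
  ... | inj₂ (eq , _)   = inj₂ (trans (sym (-‿inverseʳ x)) (+-congˡ (sym eq)))

  ∣x∣≤ : ∀ {x y} → x ≤ y → 0# ≤ x + y → ∣ x ∣ ≤ y
  ∣x∣≤ {x} {y} x≤y 0≤x+y with ∣x∣≈x∨-x x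
  ... | inj₁ (eq , _) = ≤-trans (inj₂ eq) x≤y
  ... | inj₂ (eq , _) = begin
    ∣ x ∣          ≈⟨ eq ⟩
    - x            ≈⟨ +-identityˡ (- x) ⟨
    0# - x         ≤⟨ +-monoˡ-≤ (- x) 0≤x+y ⟩
    x + y - x      ≈⟨ +-congʳ (+-comm x y) ⟩
    y + x - x      ≈⟨ x+y-y≈x y x ⟩
    y              ∎
    where open ≤-Reasoning

module _ {ℓ} (G : AbelianGroup ℓ ℓ) where
  open AbelianGroup G
  open Mult commutativeMonoid using (×-congʳ; ×-congˡ; ×-assocˡ) renaming (_×_ to _ⁿ·_)

  private
    parity : ∀ n → ∃[ k ] (n ≡ 2 ℕ.* k ⊎ n ≡ ℕ.suc (2 ℕ.* k))
    parity ℕ.zero = 0 , inj₁ ≡.refl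
    parity (ℕ.suc n) with parity n
    ... | k , inj₁ ≡.refl = k , inj₂ ≡.refl
    ... | k , inj₂ ≡.refl = ℕ.suc k , inj₁ (≡.sym (ℕ.*-suc 2 k))

  -- The axioms of a real closed field supply square roots and zeros of odd-degree polynomials.
  -- Halving a divisor until it is odd reduces all roots to these.
  odd∧2-divisible⇒divisible :
    (∀ x → ∃[ y ] 2 ⁿ· y ≈ x) →
    (∀ k x → ∃[ y ] ℕ.suc (2 ℕ.* k) ⁿ· y ≈ x) →
    ∀ n x → ∃[ y ] ℕ.suc n ⁿ· y ≈ x
  odd∧2-divisible⇒divisible half odd = <-rec _ divide
    where
    divide : ∀ n → (∀ {m} → m ℕ.< n → ∀ x → ∃[ y ] ℕ.suc m ⁿ· y ≈ x) →
             ∀ x → ∃[ y ] ℕ.suc n ⁿ· y ≈ x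
    divide n rec x with parity n
    -- The divisor is `suc n`, so an even `n` is the odd case.
    ... | k , inj₁ ≡.refl = odd k x
    ... | k , inj₂ ≡.refl with half x
    ...   | y , 2y≈x with rec (ℕ.s≤s (ℕ.m≤m+n k (k ℕ.+ 0))) y
    ...     | z , kz≈y = z , trans (×-congˡ (≡.sym (ℕ.*-suc 2 k)))
      (trans (sym (×-assocˡ z 2 (ℕ.suc k))) (trans (×-congʳ 2 kz≈y) 2y≈x))

-- The two ordered groups of a real closed field and the natural valuation

module RealClosedFieldProperties {ℓ} (R : RealClosedField ℓ) where
  open RealClosedField R
  open OrderedRingProperties orderedRing
  open SemiringMult semiring using (×-congʳ; ×-homo-+; ×-homo-1; ×-comm-*; ×-assoc-*)
  open SemiringExp semiring using (_^_; ^-assocʳ)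
  private
    module R⁺ = AbelianGroup (positiveGroup R)

  eval-monomial : ∀ n x → eval (replicate n 0# ∷ʳ 1#) x ≈ x ^ n
  eval-monomial ℕ.zero    x = trans (+-congˡ (zeroʳ x)) (+-identityʳ 1#)
  eval-monomial (ℕ.suc n) x = trans (+-identityˡ _) (*-congˡ (eval-monomial n x))

  ^-nonneg : ∀ n {x} → 0# ≤ x → 0# ≤ x ^ n
  ^-nonneg ℕ.zero    0≤x = inj₁ 0<1
  ^-nonneg (ℕ.suc n) 0≤x = *-nonneg 0≤x (^-nonneg n 0≤x)

  even-^-nonneg : ∀ k x → 0# ≤ x ^ (2 ℕ.* k)
  even-^-nonneg k x = ≤-trans
    (^-nonneg k (≤-trans (square-nonneg x) (inj₂ (*-congˡ (sym (*-identityʳ x))))))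
    (inj₂ (^-assocʳ x 2 k))

  pos-factor : ∀ {x y} → 0# ≤ y → 0# < x * y → 0# < x
  pos-factor {x} {y} (inj₂ 0≈y) 0<xy =
    contradiction 0<xy (irrefl (trans (sym (zeroʳ x)) (*-congˡ 0≈y)))
  pos-factor {x} {y} (inj₁ 0<y) 0<xy = *-cancelˡ-<-pos 0<y
    (<-respˡ-≈ (sym (zeroʳ y)) (<-respʳ-≈ (*-comm x y) 0<xy))

  -- A root of X^(2k+1) - c is positive, since its cofactor x^(2k) is a power of a square and the
  -- product is `c`.
  odd-root-pos : ∀ k {c} → 0# < c → ∃[ x ] (0# < x × x * x ^ (2 ℕ.* k) ≈ c)
  odd-root-pos k {c} 0<c
    with odd-root k (- c ∷ replicate (2 ℕ.* k) 0#) 1# (λ 1≈0 → irrefl (sym 1≈0) 0<1)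
  ... | x , root = x , pos-factor (even-^-nonneg k x) (<-respʳ-≈ (sym xⁿ≈c) 0<c) , xⁿ≈c
    where
    y = x * eval (replicate (2 ℕ.* k) 0# ∷ʳ 1#) x
    xⁿ≈c : x * x ^ (2 ℕ.* k) ≈ c
    xⁿ≈c = begin
      x * x ^ (2 ℕ.* k)  ≈⟨ *-congˡ (eval-monomial (2 ℕ.* k) x) ⟨
      y                  ≈⟨ x-y+y≈x y c ⟨
      y - c + c          ≈⟨ +-congʳ (trans (+-comm y (- c)) root) ⟩
      0# + c             ≈⟨ +-identityˡ c ⟩
      c                  ∎
      where open SetoidReasoning setoid

  sqrt-pos : ∀ {c} → 0# < c → ∃[ x ] (0# < x × x * x ≈ c)
  sqrt-pos {c} 0<c with sqrt c 0<c
  ... | x , x²≈c with compare x 0#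
  ...   | tri< x<0 _ _ = - x , neg⇒pos x<0 , trans (-x*-x≈x*x x) x²≈c
  ...   | tri≈ _ x≈0 _ = contradiction 0<c
    (irrefl (trans (sym (zeroˡ x)) (trans (*-congʳ (sym x≈0)) x²≈c)))
  ...   | tri> _ _ 0<x = x , 0<x , x²≈c

  additive : CoarselyOrderedGroup ℓ
  additive = record
    { abelianGroup       = +-abelianGroup
    ; isStrictTotalOrder = isStrictTotalOrder
    ; ∙-monoˡ-<          = +-monoˡ-<
    ; _≾_                = _≲₊_
    ; ≾-trans            = ≲₊-trans
    ; ≾-reflexive        = λ x≈y → ≤⇒≲₊ (inj₂ x≈y)
    ; <⇒≾                = λ x<y → ≤⇒≲₊ (inj₁ x<y)
    ; ∙-monoˡ-≾          = +-monoˡ-≲₊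
    ; divisible          = divisible
    }
    where
    divisible : ∀ n x → ∃[ y ] ℕ.suc n · y ≈ x
    divisible n x with inverse (ℕ.suc n · 1#) (λ n≈0 → irrefl (sym n≈0) (suc·-pos n 0<1))
    ... | y , ny≈1 = x * y , (begin
      ℕ.suc n · (x * y)         ≈⟨ ×-comm-* (ℕ.suc n) x y ⟨
      x * (ℕ.suc n · y)         ≈⟨ *-congˡ (×-congʳ (ℕ.suc n) (*-identityˡ y)) ⟨
      x * (ℕ.suc n · (1# * y))  ≈⟨ *-congˡ (×-assoc-* (ℕ.suc n) 1# y) ⟨
      x * ((ℕ.suc n · 1#) * y)  ≈⟨ *-congˡ ny≈1 ⟩
      x * 1#                    ≈⟨ *-identityʳ x ⟩
      x                         ∎)
      where open SetoidReasoning setoid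

  multiplicative : CoarselyOrderedGroup ℓ
  multiplicative = record
    { abelianGroup       = positiveGroup R
    ; isStrictTotalOrder = On.isStrictTotalOrder proj₁ isStrictTotalOrder
    ; ∙-monoˡ-<          = λ (_ , 0<z) → *-monoˡ-<-pos 0<z
    ; _≾_                = _≲_ on proj₁
    ; ≾-trans            = ≲-trans
    ; ≾-reflexive        = λ x≈y → ≤⇒≲ (inj₂ x≈y)
    ; <⇒≾                = λ x<y → ≤⇒≲ (inj₁ x<y)
    ; ∙-monoˡ-≾          = λ (_ , 0<z) → *-monoˡ-≲-pos 0<z
    ; divisible          = odd∧2-divisible⇒divisible (positiveGroup R)
        (λ (_ , 0<c) → let x , 0<x , x²≈c = sqrt-pos 0<c in
          (x , 0<x) , trans (*-congˡ (*-identityʳ x)) x²≈c)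
        (λ k (_ , 0<c) → let x , 0<x , xⁿ≈c = odd-root-pos k 0<c in
          (x , 0<x) , trans (×≈^ (ℕ.suc (2 ℕ.* k)) (x , 0<x)) xⁿ≈c)
    }
    where
    open RawMonoidDefinitions R⁺.rawMonoid using () renaming (_×_ to _ⁿ·_)
    ×≈^ : ∀ n (p : Positive R) → proj₁ (n ⁿ· p) ≈ proj₁ p ^ n
    ×≈^ ℕ.zero    p = refl
    ×≈^ (ℕ.suc n) p = *-congˡ (×≈^ n p)

  private
    module + = CoarselyOrderedGroup additive
    module * = CoarselyOrderedGroup multiplicative

    ∣1∣≈1 : ∣ 1# ∣ ≈ 1#
    ∣1∣≈1 = 0≤x⇒∣x∣≈x (inj₁ 0<1)

  ∣x∣≤n⇒≋0 : ∀ n {x} → ∣ x ∣ ≤ n · 1# → x +.≋ 0#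
  ∣x∣≤n⇒≋0 n {x} ∣x∣≤n =
    (n , ≤-trans (≤-trans (x≤∣x∣ x) ∣x∣≤n) (inj₂ (sym (+-identityˡ _)))) ,
    (n , ≤-trans (0≤x+∣x∣ x) (+-monoʳ-≤ x ∣x∣≤n))

  ≋0⇒∣x∣≤n : ∀ {x} → x +.≋ 0# → ∃[ n ] ∣ x ∣ ≤ n · 1#
  ≋0⇒∣x∣≤n {x} ((m , x≤m) , (n , 0≤x+n)) = m ℕ.+ n , ∣x∣≤ x≤m+n 0≤x+m+n
    where
    open ≤-Reasoning
    x≤m+n : x ≤ (m ℕ.+ n) · 1#
    x≤m+n = begin
      x                ≤⟨ x≤m ⟩
      0# + m · 1#      ≈⟨ +-identityˡ _ ⟩
      m · 1#           ≤⟨ ·-monoˡ-≤ m n (inj₁ 0<1) ⟩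
      (m ℕ.+ n) · 1#   ∎
    0≤x+m+n : 0# ≤ x + (m ℕ.+ n) · 1#
    0≤x+m+n = begin
      0#                       ≤⟨ 0≤x+n ⟩
      x + n · 1#               ≤⟨ +-monoʳ-≤ x (·-monoˡ-≤ n m (inj₁ 0<1)) ⟩
      x + (n ℕ.+ m) · 1#       ≡⟨ ≡.cong (λ k → x + k · 1#) (ℕ.+-comm n m) ⟩
      x + (m ℕ.+ n) · 1#       ∎

  Finite⇒≋0 : ∀ {x} → x ∈ Finite R → x +.≋ 0#
  -- An infinitesimal beats every multiplier; multiplier 1 already bounds it by 1.
  Finite⇒≋0 (inj₁ 1<ᵥx)           = ∣x∣≤n⇒≋0 1
    (inj₁ (<-respˡ-≈ (×-homo-1 _) (<-respʳ-≈ (trans ∣1∣≈1 (sym (×-homo-1 1#))) (1<ᵥx 1))))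
  Finite⇒≋0 (inj₂ (n , ∣x∣≤n , _)) = ∣x∣≤n⇒≋0 n (≤-trans ∣x∣≤n (inj₂ (×-congʳ n ∣1∣≈1)))

  -- `Finite` separates v(x) > 0 from v(x) = 0, and a bound on `∣ x ∣` does not tell which holds;
  -- `em` decides it.
  ≋0⇒Finite : ExcludedMiddle ℓ → ∀ {x} → x +.≋ 0# → x ∈ Finite R
  ≋0⇒Finite em {x} x≋0 with ≋0⇒∣x∣≤n x≋0 | em {P = ∃[ k ] ∣ 1# ∣ ≤ k · ∣ x ∣}
  ... | _         | no  ∄k             = inj₁ λ k →
    ≰⇒> λ 1≤k∣x∣ → ∄k (k , 1≤k∣x∣)
  -- One multiplier has to serve both inequalities, hence the sum.
  ... | n , ∣x∣≤n | yes (k , 1≤k∣x∣) = inj₂ (n ℕ.+ k , (begin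
    ∣ x ∣                ≤⟨ ∣x∣≤n ⟩
    n · 1#               ≤⟨ ·-monoˡ-≤ n k (inj₁ 0<1) ⟩
    (n ℕ.+ k) · 1#       ≈⟨ ×-congʳ (n ℕ.+ k) ∣1∣≈1 ⟨
    (n ℕ.+ k) · ∣ 1# ∣   ∎) , (begin
    ∣ 1# ∣               ≤⟨ 1≤k∣x∣ ⟩
    k · ∣ x ∣            ≤⟨ ·-monoˡ-≤ k n (0≤∣x∣ x) ⟩
    (k ℕ.+ n) · ∣ x ∣    ≡⟨ ≡.cong (_· ∣ x ∣) (ℕ.+-comm k n) ⟩
    (n ℕ.+ k) · ∣ x ∣    ∎))
    where open ≤-Reasoning

  PositiveUnit⇒≋1 : ∀ {p} → p ∈ PositiveUnit R → p *.≋ *.ε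
  PositiveUnit⇒≋1 {x , 0<x} (n , 1≤n∣x∣ , ∣x∣≤n∣1∣) =
    (n , ≤-trans (≤-trans (x≤∣x∣ x) ∣x∣≤n∣1∣) (inj₂ (×-congʳ n ∣1∣≈1))) ,
    (n , ≤-trans (inj₂ (sym ∣1∣≈1)) (≤-trans 1≤n∣x∣ (inj₂ (×-congʳ n (0≤x⇒∣x∣≈x (inj₁ 0<x))))))

  ≋1⇒PositiveUnit : ∀ {p} → p *.≋ *.ε → p ∈ PositiveUnit R
  ≋1⇒PositiveUnit {x , 0<x} ((m , x≤m) , (n , 1≤nx)) = n ℕ.+ m , (begin
    ∣ 1# ∣               ≈⟨ ∣1∣≈1 ⟩
    1#                   ≤⟨ 1≤nx ⟩
    n · x                ≤⟨ ·-monoˡ-≤ n m (inj₁ 0<x) ⟩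
    (n ℕ.+ m) · x        ≈⟨ ×-congʳ (n ℕ.+ m) ∣x∣≈x ⟨
    (n ℕ.+ m) · ∣ x ∣    ∎) , (begin
    ∣ x ∣                ≈⟨ ∣x∣≈x ⟩
    x                    ≤⟨ x≤m ⟩
    m · 1#               ≤⟨ ·-monoˡ-≤ m n (inj₁ 0<1) ⟩
    (m ℕ.+ n) · 1#       ≡⟨ ≡.cong (_· 1#) (ℕ.+-comm m n) ⟩
    (n ℕ.+ m) · 1#       ≈⟨ ×-congʳ (n ℕ.+ m) ∣1∣≈1 ⟨
    (n ℕ.+ m) · ∣ 1# ∣   ∎)
    where
    open ≤-Reasoning
    ∣x∣≈x = 0≤x⇒∣x∣≈x (inj₁ 0<x)

-- Powers of two in the integer part

module IntegerPartExponential {ℓ} (E : Δ₀ 2) (isExp : IsExponentialFormula ℓ E)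
  (R : RealClosedField ℓ) (I : IntegerPart (RealClosedField.orderedRing R))
  (models : ConeModelsIΔ₀ (IntegerPart.subring I))
  (total : EXP (OrderedRing.cone (IntegerPart.subring I)) E) where
  open RealClosedField R
  open OrderedRingProperties orderedRing
  open RealClosedFieldProperties R
  open SemiringMult semiring using (×-congʳ; ×-homo-1; ×-comm-*)
  private
    module I = IntegerPart I
    module M = Structure (OrderedRing.cone I.subring)
    module + = CoarselyOrderedGroup additive
    module * = CoarselyOrderedGroup multiplicative
  open ExponentialLaws (IsExponentialFormula.provable isExp I.subring models)

  2# : Carrier
  2# = 1# + 1#

  0<2 : 0# < 2#
  0<2 = <-trans 0<1 (x<x+y 1# 0<1)

  2≲1 : 2# ≲ 1#
  2≲1 = 2 , inj₂ (+-congˡ (sym (+-identityʳ 1#)))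

  ⌊_⌋ : M.Carrier → Carrier
  ⌊ (x , _) , _ ⌋ = x

  Exp : Rel M.Carrier ℓ
  Exp x p = OrderedRing.cone I.subring ⊨ E [ x ∷ p ∷ [] ]

  discrete : ∀ {z} → z ∈ I.Z → 0# < z → 1# ≤ z
  discrete {z} z∈ 0<z with ≤-total 1# z
  ... | inj₁ 1≤z        = 1≤z
  ... | inj₂ (inj₁ z<1) = contradiction (0<z , z<1) (I.isDiscrete (z , z∈))
  ... | inj₂ (inj₂ z≈1) = inj₂ (sym z≈1)

  -- If `p` were zero, `sum` would give `x + 1` the power `p * 2`, which is again zero, against
  -- `monotone`.
  Exp⇒pos : ∀ {x p} → Exp x p → 0# < ⌊ p ⌋
  Exp⇒pos {p = _ , inj₁ 0<p} _ = 0<p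
  Exp⇒pos {x} {p = p@(_ , inj₂ 0≈p)} Exp-x-p = contradiction
    (monotone _ _ _ _ Exp-x-p (sum _ _ _ _ Exp-x-p exp-1) (x<x+y ⌊ x ⌋ 0<1))
    (irrefl (trans (sym 0≈p) (trans (sym (zeroˡ 2#)) (*-congʳ 0≈p))))

  exp-standard : ∀ n → ∃[ x ] ∃[ p ] (Exp x p × ⌊ x ⌋ ≈ n · 1# × ⌊ p ⌋ ≲ 1#)
  exp-standard ℕ.zero = _ , _ , exp-0 , refl , ≤⇒≲ (inj₂ refl)
  exp-standard (ℕ.suc n) with exp-standard n
  ... | x , p , Exp-x-p , x≈n , p≲1 = _ , _ , sum _ _ _ _ exp-1 Exp-x-p , +-congˡ x≈n ,
    ≲-trans (*-monoʳ-≲-pos 0<2 p≲1) (≲-trans (≤⇒≲ (inj₂ (*-identityʳ 2#))) 2≲1)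

  exp-mono-≲ : ∀ {x y p q} → Exp x p → Exp y q → ⌊ x ⌋ ≲₊ ⌊ y ⌋ → ⌊ p ⌋ ≲ ⌊ q ⌋
  -- The exponent `suc n` instead of `n` produces the strict inequality that `monotone` asks for.
  exp-mono-≲ {x} {y} {p} {q} Exp-x-p Exp-y-q (n , x≤y+n) with exp-standard (ℕ.suc n)
  ... | e , d , Exp-e-d , e≈1+n , d≲1 =
    ≲-trans (≤⇒≲ (inj₁ (monotone _ _ _ _ Exp-x-p (sum _ _ _ _ Exp-y-q Exp-e-d) x<y+e)))
    (≲-trans (*-monoʳ-≲-pos (Exp⇒pos Exp-y-q) d≲1) (≤⇒≲ (inj₂ (*-identityʳ ⌊ q ⌋))))
    where
    open ≤-Reasoning
    x<y+e : ⌊ x ⌋ < ⌊ y ⌋ + ⌊ e ⌋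
    x<y+e = begin-strict
      ⌊ x ⌋                    ≤⟨ x≤y+n ⟩
      ⌊ y ⌋ + n · 1#           <⟨ +-monoʳ-< ⌊ y ⌋ (x<x+y (n · 1#) 0<1) ⟩
      ⌊ y ⌋ + (n · 1# + 1#)    ≈⟨ +-congˡ (+-comm (n · 1#) 1#) ⟩
      ⌊ y ⌋ + ℕ.suc n · 1#     ≈⟨ +-congˡ e≈1+n ⟨
      ⌊ y ⌋ + ⌊ e ⌋            ∎

  -- For `y < x` the difference `d` has a power `D` by totality. `growth` bounds `d` by `D`, and `D`
  -- is finite because `q * D` is bounded by a finite multiple of `q`.
  exp-cancel-≲ : ∀ {x y p q} → Exp x p → Exp y q → ⌊ p ⌋ ≲ ⌊ q ⌋ → ⌊ x ⌋ ≲₊ ⌊ y ⌋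
  exp-cancel-≲ {x} {y} {p} {q} Exp-x-p Exp-y-q p≲q with compare ⌊ x ⌋ ⌊ y ⌋
  ... | tri< x<y _ _ = ≤⇒≲₊ (inj₁ x<y)
  ... | tri≈ _ x≈y _ = ≤⇒≲₊ (inj₂ x≈y)
  ... | tri> _ _ y<x = m , (begin
    ⌊ x ⌋                      ≈⟨ y+d≈x ⟨
    ⌊ y ⌋ + ⌊ d ⌋              <⟨ +-monoʳ-< ⌊ y ⌋ (x<x+y ⌊ d ⌋ 0<1) ⟩
    ⌊ y ⌋ + (⌊ d ⌋ + 1#)       ≤⟨ +-monoʳ-≤ ⌊ y ⌋ (growth d D (discrete (proj₂ (proj₁ d)) 0<d) Exp-d-D) ⟩
    ⌊ y ⌋ + ⌊ D ⌋              <⟨ +-monoʳ-< ⌊ y ⌋ D<m ⟩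
    ⌊ y ⌋ + m · 1#             ∎)
    where
    open ≤-Reasoning
    0<d : 0# < ⌊ x ⌋ - ⌊ y ⌋
    0<d = <⇒0<- y<x
    d : M.Carrier
    d = (⌊ x ⌋ - ⌊ y ⌋ , I.+-∈ (proj₂ (proj₁ x)) (I.-‿∈ (proj₂ (proj₁ y)))) , inj₁ 0<d
    y+d≈x : ⌊ y ⌋ + ⌊ d ⌋ ≈ ⌊ x ⌋
    y+d≈x = trans (+-comm ⌊ y ⌋ ⌊ d ⌋) (x-y+y≈x ⌊ x ⌋ ⌊ y ⌋)
    D : M.Carrier
    D = proj₁ (total d)
    Exp-d-D : Exp d D
    Exp-d-D = proj₁ (proj₂ (total d))
    -- The sum of `y` and `d` equals `x` only up to `_≈_`. Comparing it strictly with `x + 1` costs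
    -- a harmless factor 2 and avoids transporting `Exp`.
    qD<2p : ⌊ q ⌋ * ⌊ D ⌋ < ⌊ p ⌋ * 2#
    qD<2p = monotone _ _ _ _ (sum _ _ _ _ Exp-y-q Exp-d-D) (sum _ _ _ _ Exp-x-p exp-1)
      (<-respˡ-≈ (sym y+d≈x) (x<x+y ⌊ x ⌋ 0<1))
    2p≲q : ⌊ p ⌋ * 2# ≲ ⌊ q ⌋
    2p≲q = ≲-trans (*-monoʳ-≲-pos (Exp⇒pos Exp-x-p) 2≲1)
      (≲-trans (≤⇒≲ (inj₂ (*-identityʳ ⌊ p ⌋))) p≲q)
    m : ℕ
    m = proj₁ 2p≲q
    D<m : ⌊ D ⌋ < m · 1#
    D<m = *-cancelˡ-<-pos (Exp⇒pos Exp-y-q) (begin-strict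
      ⌊ q ⌋ * ⌊ D ⌋          <⟨ qD<2p ⟩
      ⌊ p ⌋ * 2#             ≤⟨ proj₂ 2p≲q ⟩
      m · ⌊ q ⌋              ≈⟨ ×-congʳ m (*-identityʳ ⌊ q ⌋) ⟨
      m · (⌊ q ⌋ * 1#)       ≈⟨ ×-comm-* m ⌊ q ⌋ 1# ⟨
      ⌊ q ⌋ * (m · 1#)       ∎)

  -- Elements of the cone carry membership proofs that elements of `R` lack. Matching values up to
  -- `_≈_` bridges this without asking whether truth of `E` respects `_≈_`.
  record Power (x : Carrier) (p : Positive R) : Set ℓ where
    constructor mkPower
    field
      {x̂ p̂} : M.Carrier
      Exp-x̂-p̂ : Exp x̂ p̂
      x≈x̂ : x ≈ ⌊ x̂ ⌋
      p≈p̂ : proj₁ p ≈ ⌊ p̂ ⌋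

  Exp⇒Power : ∀ {x p} (Exp-x-p : Exp x p) → Power ⌊ x ⌋ (⌊ p ⌋ , Exp⇒pos Exp-x-p)
  Exp⇒Power Exp-x-p = mkPower Exp-x-p refl refl

  power : ∀ x → ∃[ p ] Power ⌊ x ⌋ p
  power x = _ , Exp⇒Power (proj₁ (proj₂ (total x)))

  zero-power : ∃[ p ] Power 0# p
  zero-power = _ , Exp⇒Power exp-0

  NearDifference : Carrier → Set ℓ
  NearDifference a = ∃[ x ] ∃[ y ] ∃[ p ] ∃[ q ] (Power x p × Power y q × a + y +.≋ x)

  -- Exponents must be non-negative, so a negative floor `z` is presented as 0 minus `- z`.
  nearDifference : ∀ a → NearDifference a
  nearDifference a with I.floor a
  ... | z , z∈ , z≤a , a<z+1 with ≤-total 0# z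
  ...   | inj₁ 0≤z = _ , _ , _ , _ , proj₂ (power ((z , z∈) , 0≤z)) , proj₂ zero-power ,
    +.≋-trans (+.≋-reflexive (+-identityʳ a)) a≋z
    where
    a≋z : a +.≋ z
    a≋z = (1 , inj₁ (<-respʳ-≈ (+-congˡ (sym (×-homo-1 1#))) a<z+1)) , ≤⇒≲₊ z≤a
  ...   | inj₂ z≤0 = _ , _ , _ , _ , proj₂ zero-power , proj₂ (power ((- z , I.-‿∈ z∈) , 0≤-z)) ,
    +.≋⇒∙⁻¹≋ε ((1 , inj₁ (<-respʳ-≈ (+-congˡ (sym (×-homo-1 1#))) a<z+1)) , ≤⇒≲₊ z≤a)
    where
    0≤-z : 0# ≤ - z
    0≤-z = ≤-trans (inj₂ (sym (-‿inverseʳ z)))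
      (≤-trans (+-monoˡ-≤ (- z) z≤0) (inj₂ (+-identityˡ (- z))))

  NearQuotient : Positive R → Set ℓ
  NearQuotient b = ∃[ x ] ∃[ y ] ∃[ p ] ∃[ q ] (Power x p × Power y q × b *.∙ q *.≋ p)

  -- With `z` the floor of `b` and `p` the power of its logarithm, p ≤ z ≤ b < z + 1 ≤ 2z < 4p; the
  -- denominator is the power of 0.
  nearQuotient-≥1 : ∀ b → 1# ≤ proj₁ b → NearQuotient b
  nearQuotient-≥1 (b , 0<b) 1≤b = fromFloor (I.floor b)
    where
    open ≤-Reasoning
    fromFloor : ∃[ z ] (z ∈ I.Z × z ≤ b × b < z + 1#) → NearQuotient (b , 0<b)
    fromFloor (z , z∈ , z≤b , b<z+1)
      with logarithm ((z , z∈) , inj₁ 0<z) (discrete z∈ 0<z)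
      where
      0<z : 0# < z
      0<z = +-cancelʳ-< 1# (begin-strict
        0# + 1#  ≈⟨ +-identityˡ 1# ⟩
        1#       ≤⟨ 1≤b ⟩
        b        <⟨ b<z+1 ⟩
        z + 1#   ∎)
    ... | x , (p , Exp-x-p , p≤z , z<2p) , _ =
      _ , _ , _ , _ , Exp⇒Power Exp-x-p , proj₂ zero-power ,
      ≲-trans (≤⇒≲ (inj₂ (*-identityʳ b))) (≲-trans b≲z z≲p) ,
      ≤⇒≲ (≤-trans p≤z (≤-trans z≤b (inj₂ (sym (*-identityʳ b)))))
      where
      0<p = Exp⇒pos Exp-x-p
      1≤z : 1# ≤ z
      1≤z = discrete z∈ (<-≤-trans 0<p p≤z)
      b≲z : b ≲ z
      b≲z = 2 , (begin
        b          <⟨ b<z+1 ⟩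
        z + 1#     ≤⟨ +-monoʳ-≤ z 1≤z ⟩
        z + z      ≈⟨ +-congˡ (+-identityʳ z) ⟨
        2 · z      ∎)
      z≲p : z ≲ ⌊ p ⌋
      z≲p = 2 , (begin
        z                  <⟨ z<2p ⟩
        2# * ⌊ p ⌋         ≈⟨ distribʳ ⌊ p ⌋ 1# 1# ⟩
        1# * ⌊ p ⌋ + 1# * ⌊ p ⌋  ≈⟨ +-cong (*-identityˡ ⌊ p ⌋) (trans (*-identityˡ ⌊ p ⌋) (sym (+-identityʳ ⌊ p ⌋))) ⟩
        2 · ⌊ p ⌋          ∎)

  -- Inversion swaps numerator and denominator. This reaches elements below 1, where `logarithm`
  -- does not apply.
  nearQuotient-⁻¹ : ∀ b → NearQuotient (b *.⁻¹) → NearQuotient b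
  nearQuotient-⁻¹ b (_ , _ , p , q , Power-x-p , Power-y-q , b⁻¹q≋p) =
    _ , _ , q , p , Power-y-q , Power-x-p ,
    *.x⁻¹∙y≋z⇒x∙z≋y b {q} {p} b⁻¹q≋p

  nearQuotient : ∀ b → NearQuotient b
  nearQuotient b with ≤-total 1# (proj₁ b)
  ... | inj₁ 1≤b = nearQuotient-≥1 b 1≤b
  ... | inj₂ b≤1 = nearQuotient-⁻¹ b (nearQuotient-≥1 (b *.⁻¹) 1≤b⁻¹)
    where
    open ≤-Reasoning
    b⁻¹ = proj₁ (b *.⁻¹)
    1≤b⁻¹ : 1# ≤ b⁻¹
    1≤b⁻¹ = begin
      1#               ≈⟨ *.inverseˡ b ⟨
      b⁻¹ * proj₁ b    ≤⟨ *-monoʳ-≤-pos (proj₂ (b *.⁻¹)) b≤1 ⟩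
      b⁻¹ * 1#         ≈⟨ *-identityʳ b⁻¹ ⟩
      b⁻¹              ∎

  power-isomorphism : CoarseIsomorphism {G = additive} {H = multiplicative}
  power-isomorphism = record
    { P     = Power
    ; P-∙   = λ (mkPower Exp-x-p x≈ p≈) (mkPower Exp-y-q y≈ q≈) →
        mkPower (sum _ _ _ _ Exp-x-p Exp-y-q) (+-cong x≈ y≈) (*-cong p≈ q≈)
    ; P-≾   = λ (mkPower Exp-x-p x≈ p≈) (mkPower Exp-y-q y≈ q≈) x≾y →
        ≲-trans (≤⇒≲ (inj₂ p≈)) (≲-trans (exp-mono-≲ Exp-x-p Exp-y-q
          (≲₊-trans (≤⇒≲₊ (inj₂ (sym x≈))) (≲₊-trans x≾y (≤⇒≲₊ (inj₂ y≈)))))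
          (≤⇒≲ (inj₂ (sym q≈))))
    ; P-≾⁻¹ = λ (mkPower Exp-x-p x≈ p≈) (mkPower Exp-y-q y≈ q≈) p≾q →
        ≲₊-trans (≤⇒≲₊ (inj₂ x≈)) (≲₊-trans (exp-cancel-≲ Exp-x-p Exp-y-q
          (≲-trans (≤⇒≲ (inj₂ (sym p≈))) (≲-trans p≾q (≤⇒≲ (inj₂ q≈)))))
          (≤⇒≲₊ (inj₂ (sym y≈))))
    ; total = nearDifference
    ; onto  = nearQuotient
    }

corollary12 : (∀ {a} → ExcludedMiddle a) →
    (∀ {c ℓ₁ ℓ₂ p} → ZornsLemma c ℓ₁ ℓ₂ p) →
    ∀ {ℓ} (E : Δ₀ 2) → IsExponentialFormula ℓ E →
    (R : RealClosedField ℓ) →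
    ¬ RealClosedField.IsArchimedean R →
    Σ[ I ∈ IntegerPart (RealClosedField.orderedRing R) ]
    (ConeModelsIΔ₀ (IntegerPart.subring I) × EXP (OrderedRing.cone (IntegerPart.subring I)) E) →
    LeftExponential R
corollary12 em zorn E isExp R _ (I , models , total) = record
  { source        = SpanningTransversal.complement S Finite⇒≋0 (≋0⇒Finite em)
  ; target        = SpanningTransversal.complement T
                      (λ {p} → PositiveUnit⇒≋1 {p}) (λ {p} → ≋1⇒PositiveUnit {p})
  ; exp           = exp iso S T
  ; isIsomorphism = exp-isIsomorphism iso S T
  ; exp-mono-<    = exp-mono-< iso S T
  }
  where
  open RealClosedFieldProperties R
  iso = IntegerPartExponential.power-isomorphism E isExp R I models total
  S = spanningTransversal additive em zorn
  T = spanningTransversal multiplicative em zorn
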